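{- Let $n\ge2$ be even. The Newton polynomial in $z$ for the strip of squares with $n$ black nodes on the torus is $$\mathcal P_n^{\mathrm{sq}}(z)=z^{ -n/2}\sum_{p=0}^n(-1)^p z^p\,b_{n,p}=z^{ -n/2}\sum_{p=0}^n(-1)^pz^p\sum_{q=0}^p\frac{n\,(n-q-1)!}{q!\,(p-q)!\,(n-q-p)!},$$ where $b_{n,p}$ is the number of perfect matchings of the strip with $z$-weight $n/2-p$ (and $w$-weight $0$), and terms with $q>n-p$ are read as $0$.
   Context: Strip of squares. For even $n\ge2$, the strip of squares $\mathcal G_{2,n}$ on the torus is the multigraph with $2n$ nodes $(r,j)$, $r\in\mathbb Z/2$ (row; $r=0$ bottom, $r=1$ top), $j\in\mathbb Z/n$ (column). Node $(r,j)$ is black if $r+j$ is even and white otherwise, so there are $n$ black nodes. There are $4n$ distinct edges (parallel edges count as different): horizontal edges $h_{r,j}$ joining $(r,j)$ and $(r,j+1)$, and vertical edges $v_{r,j}$ joining $(r,j)$ and $(r+1,j)$, where $v_{r,j}$ is thought of as going upwards from $(r,j)$; thus $v_{0,j}$ is internal and $v_{1,j}$ crosses the cycle $z$ of the torus. Weights. A perfect matching is a set of edges touching each node exactly once. Edges are directed from black to white. The $z$-weight $n_z$ of a matching $M$ is the sum over edges $v_{1,j}\in M$ of $+1$ if $(1,j)$ is black and $-1$ if $(1,j)$ is white. The $w$-weight $n_w$ of $M$ is the sum over edges $h_{r,n-1}\in M$ (those crossing the cycle $w$) of $+1$ if $(r,n-1)$ is black and $-1$ if $(r,n-1)$ is white.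 The weight of $M$ is the pair $(n_z,n_w)$. Partition functions. The full partition function (Newton polynomial) is $\sum_{n_z,n_w}N_{n_z,n_w}(-1)^{n_z+n_w+n_zn_w}z^{n_z}w^{n_w}$, where $N_{n_z,n_w}$ is the number of perfect matchings of weight $(n_z,n_w)$. The Newton polynomial in $z$, $\mathcal P_n^{\mathrm{sq}}(z)$, is its $w^0$ part.
   Formalization: The right-hand sides carry an extra global factor (-1)^{n/2}: with the sign (-1)^{n_z+n_w+n_z n_w} of the partition function the printed identity fails for n ≡ 2 mod 4 (for n = 2 the w^0 part is 4 - z - 1/z, not z - 4 + 1/z); for 4 | n it is the printed identity. -}

module Defs where

open import Data.Bool using (if_then_else_)
open import Data.Fin using (Fin; zero; suc; toℕ)
import Data.Fin.Properties as Fin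
open import Data.Fin.Subset using (Subset; Side; inside; outside; _∈_)
open import Data.Fin.Subset.Properties using (_∈?_)
open import Data.Integer as ℤ using (ℤ; +_; ∣_∣; 0ℤ; 1ℤ; -1ℤ)
import Data.Integer.Properties as ℤ
open import Data.List using (List; []; _∷_; _++_; map; foldr; filter; length;
  allFin; upTo; cartesianProductWith)
open import Data.Nat using (ℕ; zero; suc; _+_; _*_; _∸_; _≤?_; _≟_; NonZero; _!)
open import Data.Nat.Divisibility using (_∣_; _∣?_)
open import Data.Nat.DivMod using (_/_; _mod_)
open import Data.Nat.Properties using (_!≢0; m*n≢0)
open import Data.Product using (_×_; _,_)
open import Data.Product.Properties using (≡-dec)
open import Data.Rational as ℚ using (ℚ; 0ℚ; 1ℚ)
open import Data.Sum using (_⊎_)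
open import Data.Vec using (Vec; []; _∷_; lookup)
open import Relation.Binary.PropositionalEquality using (_≡_)
open import Relation.Nullary using (Dec; does)
open import Relation.Nullary.Decidable using (_×-dec_; _⊎-dec_)

------------------------------------------------------------------------
-- The strip of squares on the torus

-- Successor in ℤ/n.
next : ∀ {n} → Fin n → Fin n
next {suc m} j = suc (toℕ j) mod suc m

-- (row , column); row 0 is the bottom row.
Node : ℕ → Set
Node n = Fin 2 × Fin n

Black : ∀ {n} → Node n → Set
Black (r , j) = 2 ∣ toℕ r + toℕ j

black? : ∀ {n} (x : Node n) → Dec (Black x)
black? (r , j) = 2 ∣? toℕ r + toℕ j

-- Edges are named rather than given by their end nodes: v 0F j and v 1F j
-- are parallel, and so are h r 0F and h r 1F when n = 2.
data Edge (n : ℕ) : Set where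
  h v : Fin 2 → Fin n → Edge n

source target : ∀ {n} → Edge n → Node n
source (h r j) = r , j
source (v r j) = r , j
target (h r j) = r , next j
target (v r j) = next r , j

edges : ∀ n → List (Edge n)
edges n = cartesianProductWith h (allFin 2) (allFin n)
       ++ cartesianProductWith v (allFin 2) (allFin n)

Touches : ∀ {n} → Edge n → Node n → Set
Touches e x = source e ≡ x ⊎ target e ≡ x

touches? : ∀ {n} (e : Edge n) (x : Node n) → Dec (Touches e x)
touches? e x = (source e ≟ₙ x) ⊎-dec (target e ≟ₙ x)
  where _≟ₙ_ = ≡-dec Fin._≟_ Fin._≟_

------------------------------------------------------------------------
-- Sets of edges and perfect matchings

record EdgeSet (n : ℕ) : Set where
  constructor edgeSet
  field
    horizontal vertical : Vec (Subset n) 2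

open EdgeSet public

_∈ₑ_ : ∀ {n} → Edge n → EdgeSet n → Set
h r j ∈ₑ M = j ∈ lookup (horizontal M) r
v r j ∈ₑ M = j ∈ lookup (vertical M) r

_∈ₑ?_ : ∀ {n} (e : Edge n) (M : EdgeSet n) → Dec (e ∈ₑ M)
h r j ∈ₑ? M = j ∈? lookup (horizontal M) r
v r j ∈ₑ? M = j ∈? lookup (vertical M) r

-- All vectors with entries from a given list.
vectors : ∀ {A : Set} → List A → ∀ n → List (Vec A n)
vectors xs zero    = [] ∷ []
vectors xs (suc n) = cartesianProductWith _∷_ xs (vectors xs n)

-- Every set of edges occurs exactly once.
edgeSets : ∀ n → List (EdgeSet n)
edgeSets n = cartesianProductWith edgeSet rows rows
  where rows = vectors (vectors (outside ∷ inside ∷ []) n) 2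

degree : ∀ {n} → EdgeSet n → Node n → ℕ
degree {n} M x = length (filter (λ e → (e ∈ₑ? M) ×-dec touches? e x) (edges n))

PerfectMatching : ∀ {n} → EdgeSet n → Set
PerfectMatching M = ∀ r j → degree M (r , j) ≡ 1

perfectMatching? : ∀ {n} (M : EdgeSet n) → Dec (PerfectMatching M)
perfectMatching? M = Fin.all? λ r → Fin.all? λ j → degree M (r , j) ≟ 1

------------------------------------------------------------------------
-- Weights

colourSign : ∀ {n} → Node n → ℤ
colourSign x = if does (black? x) then 1ℤ else -1ℤ

zSign : ∀ {n} → Edge n → ℤ
zSign (h _ _)         = 0ℤ
zSign (v zero j)      = 0ℤ
zSign (v (suc r) j)   = colourSign (suc r , j)

wSign : ∀ {n} → Edge n → ℤ
wSign {n} (h r j) = if does (suc (toℕ j) ≟ n) then colourSign (r , j) else 0ℤ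
wSign     (v _ _) = 0ℤ

sumOver : ∀ {n} → (Edge n → ℤ) → EdgeSet n → ℤ
sumOver {n} f M = foldr ℤ._+_ 0ℤ (map f (filter (_∈ₑ? M) (edges n)))

zWeight wWeight : ∀ {n} → EdgeSet n → ℤ
zWeight = sumOver zSign
wWeight = sumOver wSign

N : ℕ → ℤ → ℤ → ℕ
N n a b = length (filter
  (λ M → perfectMatching? M ×-dec (zWeight M ℤ.≟ a) ×-dec (wWeight M ℤ.≟ b))
  (edgeSets n))

b : ℕ → ℕ → ℕ
b n p = N n (+ (n / 2) ℤ.- + p) 0ℤ

------------------------------------------------------------------------
-- Laurent polynomials

-- Laurent polynomials are represented by their coefficient functions and
-- compared with _≗_.  Coefficients are rational so that the quotients of
-- factorials below are genuine quotients.
Laurent Laurent₂ : Set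
Laurent  = ℤ → ℚ
Laurent₂ = ℤ → ℤ → ℚ

fromℕ : ℕ → ℚ
fromℕ k = + k ℚ./ 1

-- (-1)ᵏ, which depends only on the parity of ∣ k ∣.
-1^_ : ℤ → ℚ
-1^ k = (-1ℤ ℤ.^ ∣ k ∣) ℚ./ 1

z^_ : ℤ → Laurent
(z^ k) i = if does (i ℤ.≟ k) then 1ℚ else 0ℚ

infixr 7 _·_ z^_⊛_
infix  9 -1^_ z^_

_·_ : ℚ → Laurent → Laurent
(c · f) i = c ℚ.* f i

-- The product of zᵏ and f.
z^_⊛_ : ℤ → Laurent → Laurent
(z^ k ⊛ f) i = f (i ℤ.- k)

∑[≤_] : ℕ → (ℕ → ℚ) → ℚ
∑[≤ m ] f = foldr ℚ._+_ 0ℚ (map f (upTo (suc m)))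

∑ᴸ[≤_] : ℕ → (ℕ → Laurent) → Laurent
∑ᴸ[≤ m ] f i = ∑[≤ m ] λ p → f p i

partitionFunction : ℕ → Laurent₂
partitionFunction n a b = -1^ (a ℤ.+ b ℤ.+ a ℤ.* b) ℚ.* fromℕ (N n a b)

w⁰-part : Laurent₂ → Laurent
w⁰-part f a = f a 0ℤ

-- With these signs the coefficients at z^(±n/2) are (-1)^(n/2), so that
-- newtonInZ n is z^(-n/2) ∑ (-1)ᵖ zᵖ b n p times the global sign (-1)^(n/2).
-- For example, newtonInZ 2 is 4 - z - z⁻¹.
newtonInZ : ℕ → Laurent
newtonInZ n = w⁰-part (partitionFunction n)

------------------------------------------------------------------------
-- The explicit coefficients

-- For q ≤ p, p + q ≤ n and n ≥ 1 every subtraction is exact; in particular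
-- q ≤ n / 2 < n.
term : ℕ → ℕ → ℕ → ℚ
term n p q =
  if does (q ≤? n ∸ p)
  then + (n * (n ∸ q ∸ 1) !) ℚ./ (q ! * (p ∸ q) ! * (n ∸ q ∸ p) !)
  else 0ℚ
  where
  instance
    nonZero : NonZero (q ! * (p ∸ q) ! * (n ∸ q ∸ p) !)
    nonZero = m*n≢0 _ _ {{m*n≢0 _ _ {{q !≢0}} {{(p ∸ q) !≢0}}}} {{(n ∸ q ∸ p) !≢0}}

module Submission where

open import Defs
open import Data.Integer as ℤ using (+_)
open import Data.Nat using (ℕ; _≤_)
open import Data.Nat.Divisibility using (_∣_)
open import Data.Nat.DivMod using (_/_)
open import Data.Product using (_×_)
open import Data.Rational as ℚ using (ℚ)
open import Relation.Binary.PropositionalEquality using (_≗_)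

open import Algebra.Core using (Op₂)
open import Algebra.Structures using (IsCommutativeMonoid)
open import Data.Bool using (if_then_else_; true; false)
import Data.Bool.Properties as Bool
open import Data.Fin using (Fin; zero; suc; toℕ; inject₁) renaming (fromℕ to last)
open import Data.Fin.Patterns using (0F; 1F)
import Data.Fin.Properties as Fin
open import Data.Fin.Relation.Unary.Top using (view; ‵fromℕ; ‵inject₁)
open import Data.Fin.Subset using (Subset; Side; inside; outside)
open import Data.Fin.Subset.Properties using (_∈?_)
open import Data.Integer using (ℤ; -[1+_]; +[1+_]; 0ℤ; 1ℤ; -1ℤ; ∣_∣)
import Data.Integer.Properties as ℤ
open import Data.Integer.Tactic.RingSolver using (solve-∀)
open import Data.List using (List; []; _∷_; _++_; map; foldr; filter; length;
  allFin; upTo; cartesianProductWith)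
open import Data.List.Membership.Propositional using (_∈_)
open import Data.List.Membership.Propositional.Properties
  using (∈-allFin; ∈-upTo⁺; ∈-upTo⁻)
import Data.List.Properties as List
open import Data.List.Relation.Unary.All as All using (All; []; _∷_)
open import Data.List.Relation.Unary.AllPairs using (_∷_)
open import Data.List.Relation.Unary.Any using (here; there)
open import Data.List.Relation.Unary.Unique.Propositional using (Unique)
open import Data.List.Relation.Unary.Unique.Propositional.Properties
  using (allFin⁺; upTo⁺)
open import Data.Nat using (zero; suc; _+_; _*_; _∸_; _!; _<_; z≤n; s≤s; s≤s⁻¹;
  _≟_; _≤?_; ⌊_/2⌋; ⌈_/2⌉; pred; NonZero; ≢-nonZero)
open import Data.Nat.Combinatorics using (_C_; nCn≡1; nCk+nC[k+1]≡[n+1]C[k+1];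
  nCk≡n!/k![n-k]!; k![n∸k]!∣n!)
open import Data.Nat.Divisibility using (divides; _∣?_; ∣-refl; ∣1⇒≡1;
  ∣m+n∣m⇒∣n; ∣m∣n⇒∣m+n)
open import Data.Nat.DivMod using (_%_; m%n<n; n%n≡0; m<n⇒m%n≡m; m*n/n≡m; m/n*n≡m)
open import Data.Nat.Properties
open import Data.Nat.Solver using (module +-*-Solver)
open import Data.Product using (_,_; proj₁; proj₂)
open import Data.Rational using (0ℚ; 1ℚ; toℚᵘ)
import Data.Rational.Properties as ℚ
open import Data.Rational.Unnormalised as ℚᵘ using (mkℚᵘ; *≡*)
import Data.Rational.Unnormalised.Properties as ℚᵘ
open import Data.Sum using (_⊎_; inj₁; inj₂)
open import Data.Vec using (Vec; []; _∷_; lookup)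
open import Function using (_∘_; _⇔_; mk⇔; Equivalence)
open import Level using (0ℓ)
open import Relation.Binary.PropositionalEquality
import Relation.Binary.Reasoning.Setoid as ≈-Reasoning
open import Relation.Nullary using (Dec; does; yes; no; ¬_; contradiction)
open import Relation.Nullary.Decidable using (_×-dec_; does-⇔; dec-true; dec-false)
open import Relation.Unary using (Pred; Decidable)

-- Both nodes of a column meet the same two vertical edges. If x, y leave the column and p, q enter
-- it in the two rows, the degree conditions give x + p = y + q, so the difference between the rows
-- only changes sign from column to column. It is therefore enough to inspect the last column, where
-- the w-weight is read off.
--
-- The crossing edges have alternating signs, starting with -1 in column 0. The index i counts
-- internal edges in positive columns, crossing edges in negative columns, and dominoes; j counts
-- the same with the signs exchanged, since a domino covers one column of each sign. This is why the
-- lemmas on chains come in pairs, one for each sign of the first column, and are proved by mutual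
-- induction.
--
-- Since n is even, a domino across the cut has its halves in column 0, which is negative, and in
-- column n - 1, which is positive. It thus takes 1 from each index, which is where D(i - 1, j - 1)
-- comes from.

-- If the horizontal edges of a matching differ between the two rows in one
-- column, they do so in every column, and the w-weight is 1 or -1.  A matching of
-- w-weight 0 therefore consists of dominoes (the same horizontal edge in both
-- rows) and one of two vertical edges in every remaining column, and can be
-- counted column by column.  Put i = n/2 - a and j = n/2 + a for the z-weight a.
-- A vertical edge adds 1 to one of i and j and a domino adds 1 to both, so strips
-- cut open between dominoes are counted by the Delannoy numbers D(i, j), and
-- those cut through a domino by D(i - 1, j - 1).  Expanding D(i, j) by the number
-- q of diagonal steps,
--   D(i, j) = ∑ (i + j - q)! / (q! (i - q)! (j - q)!),
-- gives the formula, which is symmetric in i and j.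

-- Finite sums

-- One development serves counts in ℕ, weights in ℤ and coefficients in ℚ. `∑` unfolds to the same
-- `foldr` and `map` as `sumOver` and `∑[≤_]`, so its lemmas apply to them directly.
module Summation {A : Set} {_∙_ : Op₂ A} {ε : A}
                 (isCommutativeMonoid : IsCommutativeMonoid _≡_ _∙_ ε) where

  open IsCommutativeMonoid isCommutativeMonoid
    using (assoc; comm; identityˡ; identityʳ)
  open ≡-Reasoning

  ∑ : ∀ {I : Set} → List I → (I → A) → A
  ∑ xs f = foldr _∙_ ε (map f xs)

  ∑-cong : ∀ {I : Set} (xs : List I) {f g : I → A} → f ≗ g → ∑ xs f ≡ ∑ xs g
  ∑-cong xs f≗g = cong (foldr _∙_ ε) (List.map-cong f≗g xs)

  ∑-map : ∀ {I J : Set} (g : I → J) xs f → ∑ (map g xs) f ≡ ∑ xs (f ∘ g)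
  ∑-map g xs f = cong (foldr _∙_ ε) (sym (List.map-∘ xs))

  ∑-++ : ∀ {I : Set} (xs ys : List I) f → ∑ (xs ++ ys) f ≡ ∑ xs f ∙ ∑ ys f
  ∑-++ []       ys f = sym (identityˡ _)
  ∑-++ (x ∷ xs) ys f = trans (cong (f x ∙_) (∑-++ xs ys f)) (sym (assoc _ _ _))

  ∑-cartesianProductWith : ∀ {I J K : Set} (g : I → J → K) xs ys f →
    ∑ (cartesianProductWith g xs ys) f ≡ ∑ xs λ x → ∑ ys λ y → f (g x y)
  ∑-cartesianProductWith g []       ys f = refl
  ∑-cartesianProductWith g (x ∷ xs) ys f = trans
    (∑-++ (map (g x) ys) _ f)
    (cong₂ _∙_ (∑-map (g x) ys f) (∑-cartesianProductWith g xs ys f))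

  ∑-ε : ∀ {I : Set} (xs : List I) → ∑ xs (λ _ → ε) ≡ ε
  ∑-ε []       = refl
  ∑-ε (x ∷ xs) = trans (identityˡ _) (∑-ε xs)

  ∑-∙ : ∀ {I : Set} (xs : List I) f g →
    ∑ xs (λ x → f x ∙ g x) ≡ ∑ xs f ∙ ∑ xs g
  ∑-∙ []       f g = sym (identityˡ ε)
  ∑-∙ (x ∷ xs) f g = begin
    (f x ∙ g x) ∙ ∑ xs (λ y → f y ∙ g y)  ≡⟨ cong ((f x ∙ g x) ∙_) (∑-∙ xs f g) ⟩
    (f x ∙ g x) ∙ (∑ xs f ∙ ∑ xs g)       ≡⟨ assoc _ _ _ ⟩
    f x ∙ (g x ∙ (∑ xs f ∙ ∑ xs g))       ≡⟨ cong (f x ∙_) (assoc _ _ _) ⟨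
    f x ∙ ((g x ∙ ∑ xs f) ∙ ∑ xs g)       ≡⟨ cong (λ y → f x ∙ (y ∙ ∑ xs g)) (comm _ _) ⟩
    f x ∙ ((∑ xs f ∙ g x) ∙ ∑ xs g)       ≡⟨ cong (f x ∙_) (assoc _ _ _) ⟩
    f x ∙ (∑ xs f ∙ (g x ∙ ∑ xs g))       ≡⟨ assoc _ _ _ ⟨
    (f x ∙ ∑ xs f) ∙ (g x ∙ ∑ xs g)       ∎

  ∑-swap : ∀ {I J : Set} (xs : List I) (ys : List J) (f : I → J → A) →
    ∑ xs (λ x → ∑ ys (f x)) ≡ ∑ ys (λ y → ∑ xs λ x → f x y)
  ∑-swap []       ys f = sym (∑-ε ys)
  ∑-swap (x ∷ xs) ys f = trans
    (cong (∑ ys (f x) ∙_) (∑-swap xs ys f))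
    (sym (∑-∙ ys (f x) λ y → ∑ xs λ x → f x y))

  ∑-vanishing : ∀ {I : Set} {xs : List I} {f} → All (λ x → f x ≡ ε) xs → ∑ xs f ≡ ε
  ∑-vanishing []         = refl
  ∑-vanishing (fx≡ε ∷ p) = trans (cong₂ _∙_ fx≡ε (∑-vanishing p)) (identityˡ ε)

  ∑-only : ∀ {I : Set} {x : I} {xs f} → x ∈ xs → Unique xs →
    (∀ y → x ≢ y → f y ≡ ε) → ∑ xs f ≡ f x
  ∑-only (here refl) (x∉ ∷ _) f≡ε =
    trans (cong (_ ∙_) (∑-vanishing (All.map (f≡ε _) x∉))) (identityʳ _)
  ∑-only {f = f} (there {x = y} x∈) (y∉ ∷ u) f≡ε = trans
    (cong₂ _∙_ (f≡ε y λ { refl → All.lookup y∉ x∈ refl }) (∑-only x∈ u f≡ε))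
    (identityˡ _)

  ∑-allFin-suc : ∀ n f → ∑ (allFin (suc n)) f ≡ f zero ∙ ∑ (allFin n) (f ∘ suc)
  ∑-allFin-suc n f = cong (f zero ∙_) (trans
    (cong (λ xs → ∑ xs f) (sym (List.map-tabulate (λ i → i) suc)))
    (∑-map suc (allFin n) f))

  ∑-upTo-suc : ∀ n f → ∑ (upTo (suc n)) f ≡ f 0 ∙ ∑ (upTo n) (f ∘ suc)
  ∑-upTo-suc n f = cong (f 0 ∙_) (trans
    (cong (λ xs → ∑ xs f) (sym (List.map-upTo suc n)))
    (∑-map suc (upTo n) f))

  ∑-filter : ∀ {I : Set} {P : Pred I 0ℓ} (P? : Decidable P) xs f →
    ∑ (filter P? xs) f ≡ ∑ xs λ x → if does (P? x) then f x else ε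
  ∑-filter P? []       f = refl
  ∑-filter P? (x ∷ xs) f with does (P? x)
  ... | true  = cong (f x ∙_) (∑-filter P? xs f)
  ... | false = trans (∑-filter P? xs f) (sym (identityˡ _))

  ∑-allFin : ∀ {n} (j : Fin n) {f} → (∀ k → j ≢ k → f k ≡ ε) → ∑ (allFin n) f ≡ f j
  ∑-allFin j = ∑-only (∈-allFin j) (allFin⁺ _)

  ∑-edges : ∀ n f → ∑ (edges n) f ≡
    ∑ (allFin 2) (λ r → ∑ (allFin n) λ j → f (h r j)) ∙
    ∑ (allFin 2) (λ r → ∑ (allFin n) λ j → f (v r j))
  ∑-edges n f = trans (∑-++ (cartesianProductWith h (allFin 2) (allFin n)) _ f) (cong₂ _∙_
    (∑-cartesianProductWith h (allFin 2) (allFin n) f)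
    (∑-cartesianProductWith v (allFin 2) (allFin n) f))

open Summation +-0-isCommutativeMonoid
module ∑ℤ = Summation ℤ.+-0-isCommutativeMonoid
module ∑ℚ = Summation ℚ.+-0-isCommutativeMonoid

-- Delannoy numbers

-- Indexed by the two parts rather than by total and part, so that no truncated subtraction occurs
-- in the recurrences.
choose : ℕ → ℕ → ℕ
choose a b = (a + b) C a

choose-zeroʳ : ∀ a → choose a 0 ≡ 1
choose-zeroʳ a = trans (cong (_C a) (+-identityʳ a)) (nCn≡1 a)

choose-suc : ∀ a b → choose (suc a) (suc b) ≡ choose a (suc b) + choose (suc a) b
choose-suc a b = begin
  suc (a + suc b) C suc a                    ≡⟨ nCk+nC[k+1]≡[n+1]C[k+1] (a + suc b) a ⟨
  (a + suc b) C a + (a + suc b) C suc a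
    ≡⟨ cong (λ n → choose a (suc b) + n C suc a) (+-suc a b) ⟩
  choose a (suc b) + choose (suc a) b        ∎
  where open ≡-Reasoning

choose-! : ∀ a b → choose a b * (a ! * b !) ≡ (a + b) !
choose-! a b = subst (λ c → choose a b * (a ! * c !) ≡ (a + b) !) (m+n∸m≡n a b) (begin
  choose a b * (a ! * (a + b ∸ a) !)
    ≡⟨ cong (_* (a ! * (a + b ∸ a) !)) (nCk≡n!/k![n-k]! (m≤m+n a b)) ⟩
  (a + b) ! / (a ! * (a + b ∸ a) !) * (a ! * (a + b ∸ a) !)
    ≡⟨ m/n*n≡m (k![n∸k]!∣n! (m≤m+n a b)) ⟩
  (a + b) ! ∎)
  where
  open ≡-Reasoning
  instance _ = a !* (a + b ∸ a) !≢0

-- The multinomial coefficient (a + b + c)! / (a! b! c!), as a product of binomials to stay within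
-- ℕ. It counts the paths with a diagonal steps and b and c steps along the axes.
trinomial : ℕ → ℕ → ℕ → ℕ
trinomial a b c = choose a (b + c) * choose b c

trinomial-zeroᵐ : ∀ a c → trinomial a 0 c ≡ choose a c
trinomial-zeroᵐ a c = *-identityʳ (choose a c)

trinomial-zeroʳ : ∀ a b → trinomial a b 0 ≡ choose a b
trinomial-zeroʳ a b rewrite +-identityʳ b | nCn≡1 b = *-identityʳ (choose a b)

trinomial-suc : ∀ a b c → trinomial (suc a) (suc b) (suc c) ≡
  trinomial a (suc b) (suc c) + (trinomial (suc a) b (suc c) + trinomial (suc a) (suc b) c)
trinomial-suc a b c = begin
  choose (suc a) (suc (b + suc c)) * choose (suc b) (suc c)
    ≡⟨ cong (_* choose (suc b) (suc c)) (choose-suc a (b + suc c)) ⟩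
  (choose a (suc (b + suc c)) + n) * choose (suc b) (suc c)
    ≡⟨ *-distribʳ-+ (choose (suc b) (suc c)) (choose a (suc (b + suc c))) n ⟩
  trinomial a (suc b) (suc c) + n * choose (suc b) (suc c)
    ≡⟨ cong (λ k → trinomial a (suc b) (suc c) + n * k) (choose-suc b c) ⟩
  trinomial a (suc b) (suc c) + n * (choose b (suc c) + choose (suc b) c)
    ≡⟨ cong (_+_ (trinomial a (suc b) (suc c))) (*-distribˡ-+ n _ _) ⟩
  trinomial a (suc b) (suc c) + (trinomial (suc a) b (suc c) + n * choose (suc b) c)
    ≡⟨ cong (λ k → trinomial a (suc b) (suc c) +
                   (trinomial (suc a) b (suc c) + choose (suc a) k * choose (suc b) c))
         (+-suc b c) ⟩
  trinomial a (suc b) (suc c) + (trinomial (suc a) b (suc c) + trinomial (suc a) (suc b) c)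
    ∎
  where
  open ≡-Reasoning
  n = choose (suc a) (b + suc c)

trinomial-! : ∀ a b c → trinomial a b c * (a ! * b ! * c !) ≡ (a + (b + c)) !
trinomial-! a b c = begin
  choose a (b + c) * choose b c * (a ! * b ! * c !)
    ≡⟨ solve 5 (λ x y a b c → x :* y :* (a :* b :* c) := x :* (a :* (y :* (b :* c)))) refl
         (choose a (b + c)) (choose b c) (a !) (b !) (c !) ⟩
  choose a (b + c) * (a ! * (choose b c * (b ! * c !)))
    ≡⟨ cong (λ k → choose a (b + c) * (a ! * k)) (choose-! b c) ⟩
  choose a (b + c) * (a ! * (b + c) !)
    ≡⟨ choose-! a (b + c) ⟩
  (a + (b + c)) ! ∎
  where
  open ≡-Reasoning
  open +-*-Solver

-- The sum of f q (i - q) (j - q) over q from 0 to the smaller of i and j, written as a recursion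
-- that needs no subtraction.
diagonal : (ℕ → ℕ → ℕ → ℕ) → ℕ → ℕ → ℕ
diagonal f zero    j       = f 0 zero j
diagonal f (suc i) zero    = f 0 (suc i) zero
diagonal f (suc i) (suc j) = f 0 (suc i) (suc j) + diagonal (f ∘ suc) i j

delannoy : ℕ → ℕ → ℕ
delannoy zero    j       = 1
delannoy (suc i) zero    = 1
delannoy (suc i) (suc j) = delannoy i j + (delannoy i (suc j) + delannoy (suc i) j)

delannoy-comm : ∀ i j → delannoy i j ≡ delannoy j i
delannoy-comm zero    zero    = refl
delannoy-comm zero    (suc j) = refl
delannoy-comm (suc i) zero    = refl
delannoy-comm (suc i) (suc j) = cong₂ _+_ (delannoy-comm i j) (trans
  (cong₂ _+_ (delannoy-comm i (suc j)) (delannoy-comm (suc i) j))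
  (+-comm (delannoy (suc j) i) (delannoy j (suc i))))

diagonal-+ : ∀ f g i j →
  diagonal (λ a b c → f a b c + g a b c) i j ≡ diagonal f i j + diagonal g i j
diagonal-+ f g zero    j       = refl
diagonal-+ f g (suc i) zero    = refl
diagonal-+ f g (suc i) (suc j) = begin
  (f 0 (suc i) (suc j) + g 0 (suc i) (suc j)) + diagonal _ i j
    ≡⟨ cong (_+_ (f 0 (suc i) (suc j) + g 0 (suc i) (suc j))) (diagonal-+ (f ∘ suc) (g ∘ suc) i j) ⟩
  (f 0 (suc i) (suc j) + g 0 (suc i) (suc j)) + (diagonal (f ∘ suc) i j + diagonal (g ∘ suc) i j)
    ≡⟨ solve 4 (λ w x y z → (w :+ x) :+ (y :+ z) := (w :+ y) :+ (x :+ z)) refl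
         (f 0 (suc i) (suc j)) (g 0 (suc i) (suc j)) (diagonal (f ∘ suc) i j) (diagonal (g ∘ suc) i j) ⟩
  diagonal f (suc i) (suc j) + diagonal g (suc i) (suc j) ∎
  where
  open ≡-Reasoning
  open +-*-Solver

-- The rule for the last step of a path, with the missing neighbours left out on the boundary. Only
-- the layers `suc a` are constrained, so the property passes to `f ∘ suc`, as induction along a
-- diagonal demands.
record Pascal (f : ℕ → ℕ → ℕ → ℕ) : Set where
  field
    corner   : ∀ a → f (suc a) 0 0 ≡ f a 0 0
    left     : ∀ a c → f (suc a) 0 (suc c) ≡ f a 0 (suc c) + f (suc a) 0 c
    right    : ∀ a b → f (suc a) (suc b) 0 ≡ f a (suc b) 0 + f (suc a) b 0
    interior : ∀ a b c → f (suc a) (suc b) (suc c) ≡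
      f a (suc b) (suc c) + (f (suc a) b (suc c) + f (suc a) (suc b) c)

Pascal-∘suc : ∀ {f} → Pascal f → Pascal (f ∘ suc)
Pascal-∘suc P = record
  { corner   = corner ∘ suc
  ; left     = left ∘ suc
  ; right    = right ∘ suc
  ; interior = interior ∘ suc
  }
  where open Pascal P

Pascal-trinomial : Pascal trinomial
Pascal-trinomial = record
  { corner   = λ a → cong (_* 1) (trans (choose-zeroʳ (suc a)) (sym (choose-zeroʳ a)))
  ; left     = λ a c → begin
      trinomial (suc a) 0 (suc c)                  ≡⟨ trinomial-zeroᵐ (suc a) (suc c) ⟩
      choose (suc a) (suc c)                       ≡⟨ choose-suc a c ⟩
      choose a (suc c) + choose (suc a) c
        ≡⟨ cong₂ _+_ (trinomial-zeroᵐ a (suc c)) (trinomial-zeroᵐ (suc a) c) ⟨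
      trinomial a 0 (suc c) + trinomial (suc a) 0 c ∎
  ; right    = λ a b → begin
      trinomial (suc a) (suc b) 0                  ≡⟨ trinomial-zeroʳ (suc a) (suc b) ⟩
      choose (suc a) (suc b)                       ≡⟨ choose-suc a b ⟩
      choose a (suc b) + choose (suc a) b
        ≡⟨ cong₂ _+_ (trinomial-zeroʳ a (suc b)) (trinomial-zeroʳ (suc a) b) ⟨
      trinomial a (suc b) 0 + trinomial (suc a) b 0 ∎
  ; interior = trinomial-suc
  }
  where open ≡-Reasoning

-- Add the recurrences along the diagonal: every summand of `diagonal (f ∘ suc) i j` splits in
-- three. The two extra terms in layer 0 are the initial terms of the diagonals that end at (i, j +
-- 1) and (i + 1, j).
diagonal-pascal : ∀ {f} → Pascal f → ∀ i j →
  diagonal (f ∘ suc) i j + (f 0 i (suc j) + f 0 (suc i) j) ≡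
  diagonal f i j + (diagonal f i (suc j) + diagonal f (suc i) j)
diagonal-pascal {f} P zero zero = cong (_+ (f 0 0 1 + f 0 1 0)) (Pascal.corner P 0)
diagonal-pascal {f} P zero (suc j) = begin
  f 1 0 (suc j) + (f 0 0 (suc (suc j)) + f 0 1 (suc j))
    ≡⟨ cong (_+ (f 0 0 (suc (suc j)) + f 0 1 (suc j))) (Pascal.left P 0 j) ⟩
  (f 0 0 (suc j) + f 1 0 j) + (f 0 0 (suc (suc j)) + f 0 1 (suc j))
    ≡⟨ solve 4 (λ x y z w → (x :+ y) :+ (z :+ w) := x :+ (z :+ (w :+ y))) refl
         (f 0 0 (suc j)) (f 1 0 j) (f 0 0 (suc (suc j))) (f 0 1 (suc j)) ⟩
  f 0 0 (suc j) + (f 0 0 (suc (suc j)) + (f 0 1 (suc j) + f 1 0 j)) ∎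
  where
  open ≡-Reasoning
  open +-*-Solver
diagonal-pascal {f} P (suc i) zero = begin
  diagonal (f ∘ suc) (suc i) 0 + (f 0 (suc i) 1 + f 0 (suc (suc i)) 0)
    ≡⟨ cong (_+ (f 0 (suc i) 1 + f 0 (suc (suc i)) 0)) (Pascal.right P 0 i) ⟩
  (f 0 (suc i) 0 + f 1 i 0) + (f 0 (suc i) 1 + f 0 (suc (suc i)) 0)
    ≡⟨ cong (λ x → (f 0 (suc i) 0 + x) + (f 0 (suc i) 1 + f 0 (suc (suc i)) 0)) (diagonal-zeroʳ i) ⟨
  (f 0 (suc i) 0 + diagonal (f ∘ suc) i 0) + (f 0 (suc i) 1 + f 0 (suc (suc i)) 0)
    ≡⟨ solve 4 (λ x y z w → (x :+ y) :+ (z :+ w) := x :+ ((z :+ y) :+ w)) refl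
         (f 0 (suc i) 0) (diagonal (f ∘ suc) i 0) (f 0 (suc i) 1) (f 0 (suc (suc i)) 0) ⟩
  f 0 (suc i) 0 + ((f 0 (suc i) 1 + diagonal (f ∘ suc) i 0) + f 0 (suc (suc i)) 0) ∎
  where
  open ≡-Reasoning
  open +-*-Solver
  diagonal-zeroʳ : ∀ i → diagonal (f ∘ suc) i 0 ≡ f 1 i 0
  diagonal-zeroʳ zero    = refl
  diagonal-zeroʳ (suc i) = refl
diagonal-pascal {f} P (suc i) (suc j) = begin
  (f₁ 0 (suc i) (suc j) + diagonal (f₁ ∘ suc) i j) + (x + y)
    ≡⟨ cong (λ k → (k + diagonal (f₁ ∘ suc) i j) + (x + y)) (Pascal.interior P 0 i j) ⟩
  ((f 0 (suc i) (suc j) + (f₁ 0 i (suc j) + f₁ 0 (suc i) j)) + diagonal (f₁ ∘ suc) i j) + (x + y)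
    ≡⟨ solve 5 (λ a b c x y → ((a :+ b) :+ c) :+ (x :+ y) := (a :+ (c :+ b)) :+ (x :+ y)) refl
         (f 0 (suc i) (suc j)) (f₁ 0 i (suc j) + f₁ 0 (suc i) j) (diagonal (f₁ ∘ suc) i j) x y ⟩
  (f 0 (suc i) (suc j) + (diagonal (f₁ ∘ suc) i j + (f₁ 0 i (suc j) + f₁ 0 (suc i) j))) + (x + y)
    ≡⟨ cong (λ k → (f 0 (suc i) (suc j) + k) + (x + y)) (diagonal-pascal (Pascal-∘suc P) i j) ⟩
  (f 0 (suc i) (suc j) + (diagonal f₁ i j + (diagonal f₁ i (suc j) + diagonal f₁ (suc i) j))) + (x + y)
    ≡⟨ solve 6 (λ a b c d x y →
         (a :+ (b :+ (c :+ d))) :+ (x :+ y) := (a :+ b) :+ ((x :+ c) :+ (y :+ d))) refl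
         (f 0 (suc i) (suc j)) (diagonal f₁ i j) (diagonal f₁ i (suc j)) (diagonal f₁ (suc i) j) x y ⟩
  diagonal f (suc i) (suc j) + (diagonal f (suc i) (suc (suc j)) + diagonal f (suc (suc i)) (suc j)) ∎
  where
  open ≡-Reasoning
  open +-*-Solver
  f₁ = f ∘ suc
  x = f 0 (suc i) (suc (suc j))
  y = f 0 (suc (suc i)) (suc j)

-- Both sides obey the three-term recurrence. `diagonal-pascal` yields it up to the layer without
-- diagonal steps; there the trinomials are binomials, and `pascal₀` merges the two leftover terms.
delannoy≡diagonal : ∀ i j → delannoy i j ≡ diagonal trinomial i j
delannoy≡diagonal zero    j       = refl
delannoy≡diagonal (suc i) zero    = sym (trinomial-zeroʳ 0 (suc i))
delannoy≡diagonal (suc i) (suc j) = begin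
  delannoy i j + (delannoy i (suc j) + delannoy (suc i) j)
    ≡⟨ cong₂ _+_ (delannoy≡diagonal i j)
         (cong₂ _+_ (delannoy≡diagonal i (suc j)) (delannoy≡diagonal (suc i) j)) ⟩
  diagonal trinomial i j + (diagonal trinomial i (suc j) + diagonal trinomial (suc i) j)
    ≡⟨ diagonal-pascal Pascal-trinomial i j ⟨
  diagonal (trinomial ∘ suc) i j + (trinomial 0 i (suc j) + trinomial 0 (suc i) j)
    ≡⟨ +-comm (diagonal (trinomial ∘ suc) i j) _ ⟩
  (trinomial 0 i (suc j) + trinomial 0 (suc i) j) + diagonal (trinomial ∘ suc) i j
    ≡⟨ cong (_+ diagonal (trinomial ∘ suc) i j) (pascal₀ i j) ⟩
  trinomial 0 (suc i) (suc j) + diagonal (trinomial ∘ suc) i j ∎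
  where
  open ≡-Reasoning
  pascal₀ : ∀ b c → trinomial 0 b (suc c) + trinomial 0 (suc b) c ≡ trinomial 0 (suc b) (suc c)
  pascal₀ b c = begin
    1 * choose b (suc c) + 1 * choose (suc b) c ≡⟨ *-distribˡ-+ 1 (choose b (suc c)) _ ⟨
    1 * (choose b (suc c) + choose (suc b) c)   ≡⟨ cong (1 *_) (choose-suc b c) ⟨
    1 * choose (suc b) (suc c)                  ∎

-- The zero layer in front turns the diagonal sum at (i - 1, j - 1) into one at (i, j), so that both
-- parts of `cyclic` are summed over the same q.
shifted : (ℕ → ℕ → ℕ → ℕ) → ℕ → ℕ → ℕ → ℕ
shifted f zero    b c = 0
shifted f (suc a) b c = f a b c

-- n (a + b + c - 1)! / (a! b! c!) with n = 2 a + b + c.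
coefficient : ℕ → ℕ → ℕ → ℕ
coefficient a b c = trinomial a b c + shifted trinomial a b c

-- After multiplication by a! b! c! the first trinomial becomes (a + b + c) m! and the shifted one a
-- m!.
coefficient-! : ∀ a b c {m} → a + (b + c) ≡ suc m →
  coefficient a b c * (a ! * b ! * c !) ≡ (a + (a + (b + c))) * m !
coefficient-! zero b c {m} eq = begin
  (trinomial 0 b c + 0) * (1 * b ! * c !)  ≡⟨ cong (_* (1 * b ! * c !)) (+-identityʳ (trinomial 0 b c)) ⟩
  trinomial 0 b c * (1 * b ! * c !)        ≡⟨ trinomial-! 0 b c ⟩
  (b + c) !                                ≡⟨ cong _! eq ⟩
  suc m * m !                              ≡⟨ cong (_* m !) eq ⟨
  (b + c) * m !                            ∎
  where open ≡-Reasoning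
coefficient-! (suc a) b c refl = begin
  (trinomial (suc a) b c + trinomial a b c) * (suc a * a ! * b ! * c !)
    ≡⟨ solve 6 (λ s t k x y z → (s :+ t) :* (k :* x :* y :* z) :=
         k :* (t :* (x :* y :* z)) :+ s :* (k :* x :* y :* z)) refl
         (trinomial (suc a) b c) (trinomial a b c) (suc a) (a !) (b !) (c !) ⟩
  suc a * (trinomial a b c * (a ! * b ! * c !)) + trinomial (suc a) b c * (suc a * a ! * b ! * c !)
    ≡⟨ cong₂ (λ x y → suc a * x + y) (trinomial-! a b c) (trinomial-! (suc a) b c) ⟩
  suc a * m ! + suc m * m !
    ≡⟨ *-distribʳ-+ (m !) (suc a) (suc m) ⟨
  (suc a + suc m) * m ! ∎
  where
  open ≡-Reasoning
  open +-*-Solver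
  m = a + (b + c)

-- Extension by zero lets the z-weight be arbitrary and makes the three-term recurrence hold on the
-- boundary too. It fails only at the origin, hence the positive sum i + j in `delannoyℤ-suc` and
-- the separate lemmas for i + j = 0.
delannoyℤ : ℤ → ℤ → ℕ
delannoyℤ (+ i)    (+ j)    = delannoy i j
delannoyℤ (+ i)    -[1+ j ] = 0
delannoyℤ -[1+ i ] j        = 0

delannoyℤ-comm : ∀ i j → delannoyℤ i j ≡ delannoyℤ j i
delannoyℤ-comm (+ i)    (+ j)    = delannoy-comm i j
delannoyℤ-comm (+ i)    -[1+ j ] = refl
delannoyℤ-comm -[1+ i ] (+ j)    = refl
delannoyℤ-comm -[1+ i ] -[1+ j ] = refl

delannoyℤ-suc : ∀ i j {m} → i ℤ.+ j ≡ +[1+ m ] → delannoyℤ i j ≡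
  delannoyℤ (ℤ.pred i) (ℤ.pred j) + (delannoyℤ (ℤ.pred i) j + delannoyℤ i (ℤ.pred j))
delannoyℤ-suc +[1+ i ] +[1+ j ] eq = refl
delannoyℤ-suc +[1+ i ] (+ 0)    eq = trans (sym (delannoy-zeroʳ i)) (sym (+-identityʳ (delannoy i 0)))
  where
  delannoy-zeroʳ : ∀ i → delannoy i 0 ≡ 1
  delannoy-zeroʳ zero    = refl
  delannoy-zeroʳ (suc i) = refl
delannoyℤ-suc (+ 0)    +[1+ j ] eq = refl
delannoyℤ-suc +[1+ i ] -[1+ j ] eq = refl
delannoyℤ-suc (+ 0)    -[1+ j ] ()
delannoyℤ-suc -[1+ i ] j        eq = refl

delannoyℤ-predʳ : ∀ i j → i ℤ.+ j ≡ 0ℤ → delannoyℤ i (ℤ.pred j) ≡ 0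
delannoyℤ-predʳ (+ 0)    (+ 0)    eq = refl
delannoyℤ-predʳ +[1+ i ] -[1+ j ] eq = refl
delannoyℤ-predʳ -[1+ i ] j        eq = refl

delannoyℤ-predˡ : ∀ i j → i ℤ.+ j ≡ 0ℤ → delannoyℤ (ℤ.pred i) j ≡ 0
delannoyℤ-predˡ i j eq = trans (delannoyℤ-comm (ℤ.pred i) j)
  (delannoyℤ-predʳ j i (trans (ℤ.+-comm j i) eq))

delannoyℤ-zero : ∀ i j → i ℤ.+ j ≡ 0ℤ → delannoyℤ i j ≡ (if does (i ℤ.≟ 0ℤ) then 1 else 0)
delannoyℤ-zero (+ 0)    (+ 0)    eq = refl
delannoyℤ-zero +[1+ i ] -[1+ j ] eq = refl
delannoyℤ-zero -[1+ i ] j        eq = refl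

cyclic : ℤ → ℤ → ℕ
cyclic i j = delannoyℤ i j + delannoyℤ (ℤ.pred i) (ℤ.pred j)

cyclic-comm : ∀ i j → cyclic i j ≡ cyclic j i
cyclic-comm i j = cong₂ _+_ (delannoyℤ-comm i j) (delannoyℤ-comm (ℤ.pred i) (ℤ.pred j))

cyclic≡diagonal : ∀ i j → cyclic (+ i) (+ j) ≡ diagonal coefficient i j
cyclic≡diagonal i j = begin
  delannoy i j + delannoyℤ (ℤ.pred (+ i)) (ℤ.pred (+ j))
    ≡⟨ cong₂ _+_ (delannoy≡diagonal i j) (pred≡diagonal i j) ⟩
  diagonal trinomial i j + diagonal (shifted trinomial) i j
    ≡⟨ diagonal-+ trinomial (shifted trinomial) i j ⟨
  diagonal coefficient i j ∎
  where
  open ≡-Reasoning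
  pred≡diagonal : ∀ i j → delannoyℤ (ℤ.pred (+ i)) (ℤ.pred (+ j)) ≡ diagonal (shifted trinomial) i j
  pred≡diagonal zero    j       = refl
  pred≡diagonal (suc i) zero    = refl
  pred≡diagonal (suc i) (suc j) = delannoy≡diagonal i j

-- Chains of columns

⟦_⟧ : ∀ {P : Set} → Dec P → ℕ
⟦ P? ⟧ = if does P? then 1 else 0

bit : Side → ℕ
bit x = if x then 1 else 0

-- A strip that has been cut open: the horizontal edges in the two rows (X, Y),
-- the internal vertical edges (U) and the crossing ones (V).  The Booleans p
-- and q say whether the edges entering the first column are present, l whether
-- both edges leaving the last column are, s is the sign of the crossing edge in
-- the first column, and a the z-weight.
Chain : ∀ {m} → Side → Side → Side → ℤ → ℤ → (X Y U V : Subset m) → Set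
Chain p q l s a []      []      []      []      = p ≡ l × q ≡ l × a ≡ 0ℤ
Chain p q l s a (x ∷ X) (y ∷ Y) (u ∷ U) (w ∷ V) =
  (bit x + bit p) + (bit u + bit w) ≡ 1 ×
  (bit y + bit q) + (bit u + bit w) ≡ 1 ×
  Chain x y l (ℤ.- s) (if w then a ℤ.- s else a) X Y U V

chain? : ∀ {m} p q l s a (X Y U V : Subset m) → Dec (Chain p q l s a X Y U V)
chain? p q l s a []      []      []      []      =
  p Bool.≟ l ×-dec q Bool.≟ l ×-dec a ℤ.≟ 0ℤ
chain? p q l s a (x ∷ X) (y ∷ Y) (u ∷ U) (w ∷ V) =
  ((bit x + bit p) + (bit u + bit w) ≟ 1) ×-dec
  ((bit y + bit q) + (bit u + bit w) ≟ 1) ×-dec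
  chain? x y l (ℤ.- s) (if w then a ℤ.- s else a) X Y U V

module _ {A : Set} (xs : List A) where

  ∑⁴ : ∀ n → (Vec A n → Vec A n → Vec A n → Vec A n → ℕ) → ℕ
  ∑⁴ n f = ∑ (vectors xs n) λ X → ∑ (vectors xs n) λ Y →
           ∑ (vectors xs n) λ U → ∑ (vectors xs n) λ V → f X Y U V

  ∑⁴-cong : ∀ n {f g} → (∀ X Y U V → f X Y U V ≡ g X Y U V) → ∑⁴ n f ≡ ∑⁴ n g
  ∑⁴-cong n f≡g = ∑-cong xsⁿ λ X → ∑-cong xsⁿ λ Y → ∑-cong xsⁿ λ U → ∑-cong xsⁿ λ V →
    f≡g X Y U V
    where xsⁿ = vectors xs n

  ∑⁴-zero : ∀ n → ∑⁴ n (λ _ _ _ _ → 0) ≡ 0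
  ∑⁴-zero n = trans (∑-cong xsⁿ λ _ → trans (∑-cong xsⁿ λ _ → trans (∑-cong xsⁿ λ _ →
    ∑-ε xsⁿ) (∑-ε xsⁿ)) (∑-ε xsⁿ)) (∑-ε xsⁿ)
    where xsⁿ = vectors xs n

  ∑⁴-+ : ∀ n f g → ∑⁴ n (λ X Y U V → f X Y U V + g X Y U V) ≡ ∑⁴ n f + ∑⁴ n g
  ∑⁴-+ n f g = trans (∑-cong xsⁿ λ X → trans (∑-cong xsⁿ λ Y → trans (∑-cong xsⁿ λ U →
    ∑-∙ xsⁿ (f X Y U) (g X Y U)) (∑-∙ xsⁿ _ _)) (∑-∙ xsⁿ _ _)) (∑-∙ xsⁿ _ _)
    where xsⁿ = vectors xs n

  -- Splits off the first column of a strip: each sum over a head must be moved past the sums over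
  -- the tails that precede it.
  ∑⁴-suc : ∀ n f → ∑⁴ (suc n) f ≡
    ∑ xs λ x → ∑ xs λ y → ∑ xs λ u → ∑ xs λ w →
    ∑⁴ n λ X Y U V → f (x ∷ X) (y ∷ Y) (u ∷ U) (w ∷ V)
  ∑⁴-suc n f = trans (peel _) (∑-cong xs λ x → trans
    (swap λ X → peel _) (∑-cong xs λ y → trans
    (swap λ X → swap λ Y → peel _) (∑-cong xs λ u →
    (swap λ X → swap λ Y → swap λ U → peel _))))
    where
    xsⁿ = vectors xs n

    peel : ∀ g → ∑ (vectors xs (suc n)) g ≡ ∑ xs λ x → ∑ xsⁿ λ X → g (x ∷ X)
    peel g = ∑-cartesianProductWith _∷_ xs xsⁿ g

    swap : ∀ {g : Vec A n → ℕ} {k : Vec A n → A → ℕ} →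
      (∀ X → g X ≡ ∑ xs (k X)) → ∑ xsⁿ g ≡ ∑ xs λ x → ∑ xsⁿ λ X → k X x
    swap {k = k} g≡k = trans (∑-cong xsⁿ g≡k) (∑-swap xsⁿ xs k)

sides : List Side
sides = outside ∷ inside ∷ []

subsets : ∀ n → List (Subset n)
subsets = vectors sides

chains : ℕ → Side → Side → ℤ → ℤ → ℕ
chains m p l s a = ∑⁴ sides m λ X Y U V → ⟦ chain? p p l s a X Y U V ⟧

chains-zero : ∀ p l s a → chains 0 p l s a ≡ ⟦ chain? p p l s a [] [] [] [] ⟧
chains-zero p l s a = trans (+-identityʳ _) (trans (+-identityʳ _)
  (trans (+-identityʳ _) (+-identityʳ _)))

-- With no edge entering, the first column starts a domino or holds one vertical edge, internal or
-- crossing. For the other 13 of the 16 choices of sides the degree test computes to false.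
chains-outside : ∀ m l s a → chains (suc m) outside l s a ≡
  chains m inside l (ℤ.- s) a +
  (chains m outside l (ℤ.- s) a + chains m outside l (ℤ.- s) (a ℤ.- s))
chains-outside m l s a = trans (∑⁴-suc sides m _) nonzeroTerms
  where
  drop-zeros : ∀ x y z →
    (((z + 0) + ((y + 0) + 0)) + 0) + ((((x + 0) + 0) + 0) + 0) ≡ x + (y + z)
  drop-zeros = solve 3 (λ x y z →
    (((z :+ con 0) :+ ((y :+ con 0) :+ con 0)) :+ con 0) :+
    ((((x :+ con 0) :+ con 0) :+ con 0) :+ con 0) := x :+ (y :+ z)) refl
    where open +-*-Solver

  nonzeroTerms : (∑ sides λ x → ∑ sides λ y → ∑ sides λ u → ∑ sides λ w →
    ∑⁴ sides m λ X Y U V →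
      ⟦ chain? outside outside l s a (x ∷ X) (y ∷ Y) (u ∷ U) (w ∷ V) ⟧) ≡
    chains m inside l (ℤ.- s) a +
    (chains m outside l (ℤ.- s) a + chains m outside l (ℤ.- s) (a ℤ.- s))
  nonzeroTerms rewrite ∑⁴-zero sides m = drop-zeros
    (chains m inside l (ℤ.- s) a)
    (chains m outside l (ℤ.- s) a)
    (chains m outside l (ℤ.- s) (a ℤ.- s))

-- The entering domino already covers both nodes of the column, so nothing else may be present there
-- and the weight is unchanged.
chains-inside : ∀ m l s a → chains (suc m) inside l s a ≡ chains m outside l (ℤ.- s) a
chains-inside m l s a = trans (∑⁴-suc sides m _) nonzeroTerm
  where
  drop-zeros : ∀ x → (((x + 0) + 0) + 0) + 0 ≡ x
  drop-zeros x = trans (+-identityʳ _) (trans (+-identityʳ _)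
    (trans (+-identityʳ _) (+-identityʳ _)))

  nonzeroTerm : (∑ sides λ x → ∑ sides λ y → ∑ sides λ u → ∑ sides λ w →
    ∑⁴ sides m λ X Y U V →
      ⟦ chain? inside inside l s a (x ∷ X) (y ∷ Y) (u ∷ U) (w ∷ V) ⟧) ≡
    chains m outside l (ℤ.- s) a
  nonzeroTerm rewrite ∑⁴-zero sides m = drop-zeros (chains m outside l (ℤ.- s) a)

-- This lemma and the next three keep the index equations true when a column is removed. Since
-- `⌊ suc m /2⌋` is `⌈ m /2⌉` by definition, a negative column leaves the value of a + i alone,
-- while a positive one lowers it by 1.
shiftˡ : ∀ i j {k} → i ℤ.+ j ≡ +[1+ k ] → ℤ.pred i ℤ.+ j ≡ + k
shiftˡ i j eq = trans (ℤ.pred-+ i j) (cong ℤ.pred eq)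

shiftʳ : ∀ i j {k} → i ℤ.+ j ≡ +[1+ k ] → i ℤ.+ ℤ.pred j ≡ + k
shiftʳ i j eq = trans (ℤ.+-pred i j) (cong ℤ.pred eq)

suc+pred : ∀ a i {k} → a ℤ.+ i ≡ k → (a ℤ.+ 1ℤ) ℤ.+ ℤ.pred i ≡ k
suc+pred a i eq = trans (identity a i) eq
  where
  identity : ∀ a i → (a ℤ.+ 1ℤ) ℤ.+ (-1ℤ ℤ.+ i) ≡ a ℤ.+ i
  identity = solve-∀

pred+ : ∀ a i {k} → a ℤ.+ i ≡ +[1+ k ] → (a ℤ.+ -1ℤ) ℤ.+ i ≡ + k
pred+ a i eq = trans (identity a i) (cong ℤ.pred eq)
  where
  identity : ∀ a i → (a ℤ.+ -1ℤ) ℤ.+ i ≡ -1ℤ ℤ.+ (a ℤ.+ i)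
  identity = solve-∀

delannoyℤ-weight : ∀ a i j → a ℤ.+ i ≡ 0ℤ → i ℤ.+ j ≡ 0ℤ → ⟦ a ℤ.≟ 0ℤ ⟧ ≡ delannoyℤ i j
delannoyℤ-weight a i j ai ij = trans
  (cong (λ t → if t then 1 else 0) (does-⇔ (mk⇔
    (λ { refl → trans (sym (ℤ.+-identityˡ i)) ai })
    (λ { refl → trans (sym (ℤ.+-identityʳ a)) ai })) (a ℤ.≟ 0ℤ) (i ℤ.≟ 0ℤ)))
  (sym (delannoyℤ-zero i j ij))

-- The superscript is the sign of the crossing edge in the first column, and
-- a + i is the number of columns in which that sign is positive.
outside⇝outside⁻ : ∀ m a i j → a ℤ.+ i ≡ + ⌊ m /2⌋ → i ℤ.+ j ≡ + m →
  chains m outside outside -1ℤ a ≡ delannoyℤ i j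
outside⇝outside⁺ : ∀ m a i j → a ℤ.+ i ≡ + ⌈ m /2⌉ → i ℤ.+ j ≡ + m →
  chains m outside outside 1ℤ a ≡ delannoyℤ i j
inside⇝outside⁻ : ∀ m a i j → a ℤ.+ i ≡ + ⌊ m /2⌋ → i ℤ.+ j ≡ + m →
  chains m inside outside -1ℤ a ≡ delannoyℤ i (ℤ.pred j)
inside⇝outside⁺ : ∀ m a i j → a ℤ.+ i ≡ + ⌈ m /2⌉ → i ℤ.+ j ≡ + m →
  chains m inside outside 1ℤ a ≡ delannoyℤ (ℤ.pred i) j

outside⇝outside⁻ zero    a i j ai ij =
  trans (chains-zero outside outside -1ℤ a) (delannoyℤ-weight a i j ai ij)
outside⇝outside⁻ (suc m) a i j ai ij = begin
  chains (suc m) outside outside -1ℤ a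
    ≡⟨ chains-outside m outside -1ℤ a ⟩
  chains m inside outside 1ℤ a +
  (chains m outside outside 1ℤ a + chains m outside outside 1ℤ (a ℤ.+ 1ℤ))
    ≡⟨ cong₂ _+_ (inside⇝outside⁺ m a i (ℤ.pred j) ai (shiftʳ i j ij))
       (trans (+-comm (chains m outside outside 1ℤ a) _) (cong₂ _+_
         (outside⇝outside⁺ m (a ℤ.+ 1ℤ) (ℤ.pred i) j (suc+pred a i ai) (shiftˡ i j ij))
         (outside⇝outside⁺ m a i (ℤ.pred j) ai (shiftʳ i j ij)))) ⟩
  delannoyℤ (ℤ.pred i) (ℤ.pred j) + (delannoyℤ (ℤ.pred i) j + delannoyℤ i (ℤ.pred j))
    ≡⟨ delannoyℤ-suc i j ij ⟨
  delannoyℤ i j ∎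
  where open ≡-Reasoning
outside⇝outside⁺ zero    a i j ai ij = outside⇝outside⁻ zero a i j ai ij
outside⇝outside⁺ (suc m) a i j ai ij = begin
  chains (suc m) outside outside 1ℤ a
    ≡⟨ chains-outside m outside 1ℤ a ⟩
  chains m inside outside -1ℤ a +
  (chains m outside outside -1ℤ a + chains m outside outside -1ℤ (a ℤ.+ -1ℤ))
    ≡⟨ cong₂ _+_ (inside⇝outside⁻ m a (ℤ.pred i) j (shiftʳ a i ai) (shiftˡ i j ij))
       (cong₂ _+_
         (outside⇝outside⁻ m a (ℤ.pred i) j (shiftʳ a i ai) (shiftˡ i j ij))
         (outside⇝outside⁻ m (a ℤ.+ -1ℤ) i (ℤ.pred j) (pred+ a i ai) (shiftʳ i j ij))) ⟩
  delannoyℤ (ℤ.pred i) (ℤ.pred j) + (delannoyℤ (ℤ.pred i) j + delannoyℤ i (ℤ.pred j))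
    ≡⟨ delannoyℤ-suc i j ij ⟨
  delannoyℤ i j ∎
  where open ≡-Reasoning
inside⇝outside⁻ zero    a i j ai ij = sym (delannoyℤ-predʳ i j ij)
inside⇝outside⁻ (suc m) a i j ai ij = trans (chains-inside m outside -1ℤ a)
  (outside⇝outside⁺ m a i (ℤ.pred j) ai (shiftʳ i j ij))
inside⇝outside⁺ zero    a i j ai ij = sym (delannoyℤ-predˡ i j ij)
inside⇝outside⁺ (suc m) a i j ai ij = trans (chains-inside m outside 1ℤ a)
  (outside⇝outside⁻ m a (ℤ.pred i) j (shiftʳ a i ai) (shiftˡ i j ij))

-- A nonempty chain that ends `inside` has half a domino in its last column. The parity assumptions
-- make that column positive, so the half takes 1 from i; a half in the first column takes 1 more
-- from i or j, according to its sign. Chains from `inside` to `inside` are kept nonempty here,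
-- because `chains` counts the empty one at weight 0 and the Delannoy number does not.
outside⇝inside⁻ : ∀ m a i j → 2 ∣ m → a ℤ.+ i ≡ + ⌊ m /2⌋ → i ℤ.+ j ≡ + m →
  chains m outside inside -1ℤ a ≡ delannoyℤ (ℤ.pred i) j
outside⇝inside⁺ : ∀ m a i j → 2 ∣ suc m → a ℤ.+ i ≡ + ⌈ m /2⌉ → i ℤ.+ j ≡ + m →
  chains m outside inside 1ℤ a ≡ delannoyℤ (ℤ.pred i) j
inside⇝inside⁻ : ∀ m a i j → 2 ∣ suc m → a ℤ.+ i ≡ + ⌊ suc m /2⌋ → i ℤ.+ j ≡ +[1+ m ] →
  chains (suc m) inside inside -1ℤ a ≡ delannoyℤ (ℤ.pred i) (ℤ.pred j)
inside⇝inside⁺ : ∀ m a i j → 2 ∣ m → a ℤ.+ i ≡ + ⌈ suc m /2⌉ → i ℤ.+ j ≡ +[1+ m ] →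
  chains (suc m) inside inside 1ℤ a ≡ delannoyℤ (ℤ.pred (ℤ.pred i)) j
-- The domino that starts in the first column may itself be the one cut at the end. This is the case
-- m = 0, where the empty chain supplies the value 1 at the origin, exactly where the Delannoy
-- recurrence fails.
step⁺ : ∀ m a i j → 2 ∣ m → a ℤ.+ i ≡ + ⌈ suc m /2⌉ → i ℤ.+ j ≡ +[1+ m ] →
  chains m inside inside -1ℤ a +
  (delannoyℤ (ℤ.pred (ℤ.pred i)) j + delannoyℤ (ℤ.pred i) (ℤ.pred j)) ≡
  delannoyℤ (ℤ.pred i) j

inside⇝inside⁻ m a i j 2∣ ai ij = trans (chains-inside m inside -1ℤ a)
  (outside⇝inside⁺ m a i (ℤ.pred j) 2∣ ai (shiftʳ i j ij))
inside⇝inside⁺ m a i j 2∣ ai ij = trans (chains-inside m inside 1ℤ a)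
  (outside⇝inside⁻ m a (ℤ.pred i) j 2∣ (shiftʳ a i ai) (shiftˡ i j ij))
outside⇝inside⁻ zero          a i j 2∣ ai ij = sym (delannoyℤ-predˡ i j ij)
outside⇝inside⁻ (suc zero)    a i j 2∣ ai ij = contradiction (∣1⇒≡1 2∣) λ ()
outside⇝inside⁻ (suc (suc m)) a i j 2∣ ai ij = begin
  chains (2 + m) outside inside -1ℤ a
    ≡⟨ chains-outside (suc m) inside -1ℤ a ⟩
  chains (suc m) inside inside 1ℤ a +
  (chains (suc m) outside inside 1ℤ a + chains (suc m) outside inside 1ℤ (a ℤ.+ 1ℤ))
    ≡⟨ cong₂ _+_ (inside⇝inside⁺ m a i (ℤ.pred j) (∣m+n∣m⇒∣n 2∣ ∣-refl) ai (shiftʳ i j ij))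
       (trans (+-comm (chains (suc m) outside inside 1ℤ a) _) (cong₂ _+_
         (outside⇝inside⁺ (suc m) (a ℤ.+ 1ℤ) (ℤ.pred i) j 2∣ (suc+pred a i ai) (shiftˡ i j ij))
         (outside⇝inside⁺ (suc m) a i (ℤ.pred j) 2∣ ai (shiftʳ i j ij)))) ⟩
  delannoyℤ (ℤ.pred (ℤ.pred i)) (ℤ.pred j) +
  (delannoyℤ (ℤ.pred (ℤ.pred i)) j + delannoyℤ (ℤ.pred i) (ℤ.pred j))
    ≡⟨ delannoyℤ-suc (ℤ.pred i) j (shiftˡ i j ij) ⟨
  delannoyℤ (ℤ.pred i) j ∎
  where open ≡-Reasoning
outside⇝inside⁺ zero    a i j 2∣ ai ij = contradiction (∣1⇒≡1 2∣) λ ()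
outside⇝inside⁺ (suc m) a i j 2∣ ai ij = begin
  chains (suc m) outside inside 1ℤ a
    ≡⟨ chains-outside m inside 1ℤ a ⟩
  chains m inside inside -1ℤ a +
  (chains m outside inside -1ℤ a + chains m outside inside -1ℤ (a ℤ.+ -1ℤ))
    ≡⟨ cong (_+_ (chains m inside inside -1ℤ a)) (cong₂ _+_
         (outside⇝inside⁻ m a (ℤ.pred i) j 2∣m (shiftʳ a i ai) (shiftˡ i j ij))
         (outside⇝inside⁻ m (a ℤ.+ -1ℤ) i (ℤ.pred j) 2∣m (pred+ a i ai) (shiftʳ i j ij))) ⟩
  chains m inside inside -1ℤ a +
  (delannoyℤ (ℤ.pred (ℤ.pred i)) j + delannoyℤ (ℤ.pred i) (ℤ.pred j))
    ≡⟨ step⁺ m a i j 2∣m ai ij ⟩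
  delannoyℤ (ℤ.pred i) j ∎
  where
  open ≡-Reasoning
  2∣m = ∣m+n∣m⇒∣n {m = 2} 2∣ ∣-refl
step⁺ zero    a i j 2∣ ai ij = begin
  chains 0 inside inside -1ℤ a +
  (delannoyℤ (ℤ.pred (ℤ.pred i)) j + delannoyℤ (ℤ.pred i) (ℤ.pred j))
    ≡⟨ cong₂ _+_ (chains-zero inside inside -1ℤ a) (cong₂ _+_
         (delannoyℤ-predˡ (ℤ.pred i) j (shiftˡ i j ij))
         (delannoyℤ-predʳ (ℤ.pred i) j (shiftˡ i j ij))) ⟩
  ⟦ a ℤ.≟ 0ℤ ⟧ + 0
    ≡⟨ +-identityʳ _ ⟩
  ⟦ a ℤ.≟ 0ℤ ⟧
    ≡⟨ delannoyℤ-weight a (ℤ.pred i) j (shiftʳ a i ai) (shiftˡ i j ij) ⟩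
  delannoyℤ (ℤ.pred i) j ∎
  where open ≡-Reasoning
step⁺ (suc m) a i j 2∣ ai ij = begin
  chains (suc m) inside inside -1ℤ a +
  (delannoyℤ (ℤ.pred (ℤ.pred i)) j + delannoyℤ (ℤ.pred i) (ℤ.pred j))
    ≡⟨ cong (_+ (delannoyℤ (ℤ.pred (ℤ.pred i)) j + delannoyℤ (ℤ.pred i) (ℤ.pred j)))
       (inside⇝inside⁻ m a (ℤ.pred i) j 2∣ (shiftʳ a i ai) (shiftˡ i j ij)) ⟩
  delannoyℤ (ℤ.pred (ℤ.pred i)) (ℤ.pred j) +
  (delannoyℤ (ℤ.pred (ℤ.pred i)) j + delannoyℤ (ℤ.pred i) (ℤ.pred j))
    ≡⟨ delannoyℤ-suc (ℤ.pred i) j (shiftˡ i j ij) ⟨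
  delannoyℤ (ℤ.pred i) j ∎
  where open ≡-Reasoning

-- Indicators of decidable propositions

⟦⟧-⇔ : ∀ {A B : Set} → A ⇔ B → (a? : Dec A) (b? : Dec B) → ⟦ a? ⟧ ≡ ⟦ b? ⟧
⟦⟧-⇔ A⇔B a? b? = cong (λ t → if t then 1 else 0) (does-⇔ A⇔B a? b?)

⟦⟧-no : ∀ {A : Set} → ¬ A → (a? : Dec A) → ⟦ a? ⟧ ≡ 0
⟦⟧-no ¬a a? = cong (λ t → if t then 1 else 0) (dec-false a? ¬a)

⟦⟧-⊎ : ∀ {A B C : Set} → A ⇔ (B ⊎ C) → ¬ (B × C) →
  (a? : Dec A) (b? : Dec B) (c? : Dec C) → ⟦ a? ⟧ ≡ ⟦ b? ⟧ + ⟦ c? ⟧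
⟦⟧-⊎ A⇔ ¬BC a? (yes b) (yes c) = contradiction (b , c) ¬BC
⟦⟧-⊎ A⇔ ¬BC a? (yes b) (no ¬c) =
  cong (λ t → if t then 1 else 0) (dec-true a? (Equivalence.from A⇔ (inj₁ b)))
⟦⟧-⊎ A⇔ ¬BC a? (no ¬b) (yes c) =
  cong (λ t → if t then 1 else 0) (dec-true a? (Equivalence.from A⇔ (inj₂ c)))
⟦⟧-⊎ A⇔ ¬BC a? (no ¬b) (no ¬c) = ⟦⟧-no (λ a → case-⊎ (Equivalence.to A⇔ a)) a?
  where
  case-⊎ : ¬ (_ ⊎ _)
  case-⊎ (inj₁ b) = ¬b b
  case-⊎ (inj₂ c) = ¬c c

length-filter : ∀ {A : Set} {P : Pred A 0ℓ} (P? : Decidable P) xs →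
  length (filter P? xs) ≡ ∑ xs λ x → ⟦ P? x ⟧
length-filter P? []       = refl
length-filter P? (x ∷ xs) with does (P? x)
... | true  = cong suc (length-filter P? xs)
... | false = length-filter P? xs

does-∈? : ∀ {n} (j : Fin n) (X : Subset n) → does (j ∈? X) ≡ lookup X j
does-∈? zero    (inside  ∷ X) = refl
does-∈? zero    (outside ∷ X) = refl
does-∈? (suc j) (x ∷ X)       = does-∈? j X

-- Degrees

prev : ∀ {m} → Fin (suc m) → Fin (suc m)
prev {m} zero    = last m
prev     (suc j) = inject₁ j

next-last : ∀ m → next (last m) ≡ zero
next-last m = Fin.toℕ-injective (begin
  toℕ (next (last m))              ≡⟨ Fin.toℕ-fromℕ< (m%n<n (suc (toℕ (last m))) (suc m)) ⟩
  suc (toℕ (last m)) % suc m     ≡⟨ cong (λ k → suc k % suc m) (Fin.toℕ-fromℕ m) ⟩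
  suc m % suc m                   ≡⟨ n%n≡0 (suc m) ⟩
  0                                 ∎)
  where open ≡-Reasoning

next-inject₁ : ∀ {m} (j : Fin m) → next (inject₁ j) ≡ suc j
next-inject₁ {m} j = Fin.toℕ-injective (begin
  toℕ (next (inject₁ j))            ≡⟨ Fin.toℕ-fromℕ< (m%n<n (suc (toℕ (inject₁ j))) (suc m)) ⟩
  suc (toℕ (inject₁ j)) % suc m   ≡⟨ cong (λ k → suc k % suc m) (Fin.toℕ-inject₁ j) ⟩
  suc (toℕ j) % suc m             ≡⟨ m<n⇒m%n≡m (s≤s (Fin.toℕ<n j)) ⟩
  suc (toℕ j)                       ∎)
  where open ≡-Reasoning

next-prev : ∀ {m} (j : Fin (suc m)) → next (prev j) ≡ j
next-prev {m} zero    = next-last m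
next-prev     (suc j) = next-inject₁ j

prev-next : ∀ {m} (j : Fin (suc m)) → prev (next j) ≡ j
prev-next {m} j with view j
... | ‵fromℕ     = cong prev (next-last m)
... | ‵inject₁ i = cong prev (next-inject₁ i)

-- Two columns are the minimum for this: it makes the horizontal edges entering and leaving a node
-- distinct, so that they contribute separately to its degree.
prev≢ : ∀ {m} (j : Fin (2 + m)) → prev j ≢ j
prev≢ zero    ()
prev≢ (suc j) eq = <⇒≢ (n<1+n (toℕ j)) (trans (sym (Fin.toℕ-inject₁ j)) (cong toℕ eq))

∑-lookup : ∀ {n} (X : Subset n) j →
  ∑ (allFin n) (λ k → ⟦ k ∈? X ×-dec k Fin.≟ j ⟧) ≡ bit (lookup X j)
∑-lookup X j = begin
  ∑ (allFin _) (λ k → ⟦ k ∈? X ×-dec k Fin.≟ j ⟧)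
    ≡⟨ ∑-allFin j (λ k j≢k → ⟦⟧-no (λ (_ , k≡j) → j≢k (sym k≡j)) (k ∈? X ×-dec k Fin.≟ j)) ⟩
  ⟦ j ∈? X ×-dec j Fin.≟ j ⟧
    ≡⟨ ⟦⟧-⇔ (mk⇔ proj₁ (_, refl)) (j ∈? X ×-dec j Fin.≟ j) (j ∈? X) ⟩
  ⟦ j ∈? X ⟧
    ≡⟨ cong bit (does-∈? j X) ⟩
  bit (lookup X j) ∎
  where open ≡-Reasoning

module _ {m : ℕ} (M : EdgeSet (2 + m)) where

  ∑-horizontal : ∀ r j →
    ∑ (allFin 2) (λ r′ → ∑ (allFin (2 + m)) λ k →
      ⟦ h r′ k ∈ₑ? M ×-dec touches? (h r′ k) (r , j) ⟧) ≡
    bit (lookup (lookup (horizontal M) r) j) + bit (lookup (lookup (horizontal M) r) (prev j))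
  ∑-horizontal r j = begin
    ∑ (allFin 2) (λ r′ → ∑ (allFin (2 + m)) λ k →
      ⟦ h r′ k ∈ₑ? M ×-dec touches? (h r′ k) (r , j) ⟧)
      ≡⟨ ∑-allFin r (λ r′ r≢r′ → trans
           (∑-cong (allFin (2 + m)) λ k → ⟦⟧-no
             (λ { (_ , inj₁ refl) → r≢r′ refl ; (_ , inj₂ refl) → r≢r′ refl })
             (h r′ k ∈ₑ? M ×-dec touches? (h r′ k) (r , j)))
           (∑-ε (allFin (2 + m)))) ⟩
    ∑ (allFin (2 + m)) (λ k → ⟦ k ∈? H ×-dec touches? (h r k) (r , j) ⟧)
      ≡⟨ (∑-cong (allFin (2 + m)) λ k → ⟦⟧-⊎
           (mk⇔ (λ { (k∈ , inj₁ refl) → inj₁ (k∈ , refl)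
                   ; (k∈ , inj₂ refl) → inj₂ (k∈ , sym (prev-next k)) })
                (λ { (inj₁ (k∈ , refl)) → k∈ , inj₁ refl
                   ; (inj₂ (k∈ , refl)) → k∈ , inj₂ (cong (r ,_) (next-prev j)) }))
           (λ ((_ , k≡j) , (_ , k≡prev)) → prev≢ j (trans (sym k≡prev) k≡j))
           (k ∈? H ×-dec touches? (h r k) (r , j))
           (k ∈? H ×-dec k Fin.≟ j)
           (k ∈? H ×-dec k Fin.≟ prev j)) ⟩
    ∑ (allFin (2 + m)) (λ k → ⟦ k ∈? H ×-dec k Fin.≟ j ⟧ + ⟦ k ∈? H ×-dec k Fin.≟ prev j ⟧)
      ≡⟨ ∑-∙ (allFin (2 + m)) (λ k → ⟦ k ∈? H ×-dec k Fin.≟ j ⟧)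
                              (λ k → ⟦ k ∈? H ×-dec k Fin.≟ prev j ⟧) ⟩
    ∑ (allFin (2 + m)) (λ k → ⟦ k ∈? H ×-dec k Fin.≟ j ⟧) +
    ∑ (allFin (2 + m)) (λ k → ⟦ k ∈? H ×-dec k Fin.≟ prev j ⟧)
      ≡⟨ cong₂ _+_ (∑-lookup H j) (∑-lookup H (prev j)) ⟩
    bit (lookup H j) + bit (lookup H (prev j)) ∎
    where
    open ≡-Reasoning
    H = lookup (horizontal M) r

  -- In a strip of two rows the internal and the crossing edge of a column are parallel, so each
  -- touches both nodes whatever its row index.
  touches-vertical : ∀ r r′ {j k : Fin (2 + m)} → Touches (v r′ k) (r , j) ⇔ k ≡ j
  touches-vertical r r′ = mk⇔
    (λ { (inj₁ refl) → refl ; (inj₂ refl) → refl })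
    (λ { refl → ends r r′ })
    where
    ends : ∀ r r′ {k : Fin (2 + m)} → Touches (v r′ k) (r , k)
    ends 0F 0F = inj₁ refl
    ends 0F 1F = inj₂ refl
    ends 1F 0F = inj₂ refl
    ends 1F 1F = inj₁ refl

  ∑-vertical : ∀ r j →
    ∑ (allFin 2) (λ r′ → ∑ (allFin (2 + m)) λ k →
      ⟦ v r′ k ∈ₑ? M ×-dec touches? (v r′ k) (r , j) ⟧) ≡
    ∑ (allFin 2) (λ r′ → bit (lookup (lookup (vertical M) r′) j))
  ∑-vertical r j = ∑-cong (allFin 2) λ r′ → trans
    (∑-cong (allFin (2 + m)) λ k → ⟦⟧-⇔
      (mk⇔ (λ (k∈ , t) → k∈ , Equivalence.to (touches-vertical r r′) t)
           (λ (k∈ , e) → k∈ , Equivalence.from (touches-vertical r r′) e))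
      (v r′ k ∈ₑ? M ×-dec touches? (v r′ k) (r , j))
      (k ∈? lookup (vertical M) r′ ×-dec k Fin.≟ j))
    (∑-lookup (lookup (vertical M) r′) j)

  degree≡ : ∀ r j → degree M (r , j) ≡
    (bit (lookup (lookup (horizontal M) r) j) + bit (lookup (lookup (horizontal M) r) (prev j))) +
    ∑ (allFin 2) (λ r′ → bit (lookup (lookup (vertical M) r′) j))
  degree≡ r j = begin
    degree M (r , j)
      ≡⟨ length-filter (λ e → (e ∈ₑ? M) ×-dec touches? e (r , j)) (edges (2 + m)) ⟩
    ∑ (edges (2 + m)) (λ e → ⟦ (e ∈ₑ? M) ×-dec touches? e (r , j) ⟧)
      ≡⟨ ∑-edges (2 + m) (λ e → ⟦ (e ∈ₑ? M) ×-dec touches? e (r , j) ⟧) ⟩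
    _ ≡⟨ cong₂ _+_ (∑-horizontal r j) (∑-vertical r j) ⟩
    _ ∎
    where open ≡-Reasoning

-- p says whether the horizontal edge entering column 0 is present.
Covered : ∀ {m} → Side → (X U V : Subset m) → Set
Covered p X U V = ∀ j →
  (bit (lookup X j) + bit (lookup (p ∷ X) (inject₁ j))) + (bit (lookup U j) + bit (lookup V j)) ≡ 1

lookup-prev : ∀ {m} (X : Subset (suc m)) j →
  lookup X (prev j) ≡ lookup (lookup X (last m) ∷ X) (inject₁ j)
lookup-prev X zero    = refl
lookup-prev X (suc j) = refl

-- On the torus the edge that enters column 0 is the one that leaves the last column. Passing it as
-- the boundary value cuts the cycle open.
perfectMatching⇔covered : ∀ {m} (X Y U V : Subset (2 + m)) →
  PerfectMatching (edgeSet (X ∷ Y ∷ []) (U ∷ V ∷ [])) ⇔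
  (Covered (lookup X (last (suc m))) X U V × Covered (lookup Y (last (suc m))) Y U V)
perfectMatching⇔covered {m} X Y U V = mk⇔
  (λ P → (λ j → trans (sym (degree≡covered 0F j)) (P 0F j)) ,
         (λ j → trans (sym (degree≡covered 1F j)) (P 1F j)))
  (λ { (cX , cY) 0F j → trans (degree≡covered 0F j) (cX j)
     ; (cX , cY) 1F j → trans (degree≡covered 1F j) (cY j) })
  where
  M = edgeSet (X ∷ Y ∷ []) (U ∷ V ∷ [])
  degree≡covered : ∀ r j → let H = lookup (X ∷ Y ∷ []) r in degree M (r , j) ≡
    (bit (lookup H j) + bit (lookup (lookup H (last (suc m)) ∷ H) (inject₁ j))) +
    (bit (lookup U j) + bit (lookup V j))
  degree≡covered r j = trans (degree≡ M r j) (cong₂ _+_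
    (cong (λ s → bit (lookup H j) + bit s) (lookup-prev H j))
    (cong (_+_ (bit (lookup U j))) (+-identityʳ (bit (lookup V j)))))
    where H = lookup (X ∷ Y ∷ []) r

-- Weights

crossing : ∀ {m} → ℤ → Subset m → ℤ
crossing s []      = 0ℤ
crossing s (w ∷ V) = (if w then s else 0ℤ) ℤ.+ crossing (ℤ.- s) V

-- By definition this is `colourSign` of any node whose coordinates add up to k.
paritySign : ℕ → ℤ
paritySign k = if does (2 ∣? k) then 1ℤ else -1ℤ

paritySign-suc : ∀ k → paritySign (suc k) ≡ ℤ.- paritySign k
paritySign-suc zero    = refl
paritySign-suc (suc k) = begin
  paritySign (2 + k)       ≡⟨ cong (λ t → if t then 1ℤ else -1ℤ) (does-⇔
                                (mk⇔ (λ p → ∣m+n∣m⇒∣n p ∣-refl) (∣m∣n⇒∣m+n ∣-refl))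
                                (2 ∣? (2 + k)) (2 ∣? k)) ⟩
  paritySign k             ≡⟨ ℤ.neg-involutive (paritySign k) ⟨
  ℤ.- (ℤ.- paritySign k)   ≡⟨ cong ℤ.-_ (paritySign-suc k) ⟨
  ℤ.- paritySign (suc k)   ∎
  where open ≡-Reasoning

-- The offset k lets the induction drop a column: the tail starts at `suc k`, which is the change of
-- sign in `crossing`.
crossing≡∑ : ∀ {m} k (V : Subset m) → ∑ℤ.∑ (allFin m)
  (λ j → if does (j ∈? V) then paritySign (k + toℕ j) else 0ℤ) ≡ crossing (paritySign k) V
crossing≡∑ {zero}  k []      = refl
crossing≡∑ {suc m} k (w ∷ V) = begin
  ∑ℤ.∑ (allFin (suc m)) (λ j → if does (j ∈? (w ∷ V)) then paritySign (k + toℕ j) else 0ℤ)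
    ≡⟨ ∑ℤ.∑-allFin-suc m (λ j → if does (j ∈? (w ∷ V)) then paritySign (k + toℕ j) else 0ℤ) ⟩
  (if does (zero ∈? (w ∷ V)) then paritySign (k + 0) else 0ℤ) ℤ.+
  ∑ℤ.∑ (allFin m) (λ j → if does (j ∈? V) then paritySign (k + suc (toℕ j)) else 0ℤ)
    ≡⟨ cong₂ ℤ._+_
         (cong₂ (λ t l → if t then paritySign l else 0ℤ) (does-∈? zero (w ∷ V)) (+-identityʳ k))
         (trans (∑ℤ.∑-cong (allFin m) λ j → cong
             (λ l → if does (j ∈? V) then paritySign l else 0ℤ) (+-suc k (toℕ j)))
           (crossing≡∑ (suc k) V)) ⟩
  (if w then paritySign k else 0ℤ) ℤ.+ crossing (paritySign (suc k)) V
    ≡⟨ cong (λ s → (if w then paritySign k else 0ℤ) ℤ.+ crossing s V) (paritySign-suc k) ⟩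
  crossing (paritySign k) (w ∷ V) ∎
  where open ≡-Reasoning

sumOver≡ : ∀ {n} f (M : EdgeSet n) → sumOver f M ≡
  ∑ℤ.∑ (allFin 2) (λ r → ∑ℤ.∑ (allFin n) λ j →
    if does (j ∈? lookup (horizontal M) r) then f (h r j) else 0ℤ) ℤ.+
  ∑ℤ.∑ (allFin 2) (λ r → ∑ℤ.∑ (allFin n) λ j →
    if does (j ∈? lookup (vertical M) r) then f (v r j) else 0ℤ)
sumOver≡ {n} f M = trans (∑ℤ.∑-filter (_∈ₑ? M) (edges n) f)
  (∑ℤ.∑-edges n (λ e → if does (e ∈ₑ? M) then f e else 0ℤ))

if-zero : ∀ t → (if t then 0ℤ else 0ℤ) ≡ 0ℤ
if-zero true  = refl
if-zero false = refl

∑-if-zero : ∀ {n} (X : Subset n) → ∑ℤ.∑ (allFin n) (λ j → if does (j ∈? X) then 0ℤ else 0ℤ) ≡ 0ℤ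
∑-if-zero {n} X = trans (∑ℤ.∑-cong (allFin n) λ j → if-zero (does (j ∈? X))) (∑ℤ.∑-ε (allFin n))

-- Only the top row's vertical edges carry a sign, and the sequence starts with -1 because the node
-- (1, 0) is white.
zWeight≡crossing : ∀ {n} (X Y U V : Subset n) →
  zWeight (edgeSet (X ∷ Y ∷ []) (U ∷ V ∷ [])) ≡ crossing -1ℤ V
zWeight≡crossing {n} X Y U V = begin
  zWeight (edgeSet (X ∷ Y ∷ []) (U ∷ V ∷ []))
    ≡⟨ sumOver≡ zSign (edgeSet (X ∷ Y ∷ []) (U ∷ V ∷ [])) ⟩
  (zeros X ℤ.+ (zeros Y ℤ.+ 0ℤ)) ℤ.+ (zeros U ℤ.+ (∑ℤ.∑ (allFin n) crossings ℤ.+ 0ℤ))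
    ≡⟨ cong₂ ℤ._+_
         (cong₂ ℤ._+_ (∑-if-zero X) (cong (ℤ._+ 0ℤ) (∑-if-zero Y)))
         (cong₂ ℤ._+_ (∑-if-zero U) (trans (ℤ.+-identityʳ _) (crossing≡∑ 1 V))) ⟩
  0ℤ ℤ.+ (0ℤ ℤ.+ crossing -1ℤ V)
    ≡⟨ trans (ℤ.+-identityˡ _) (ℤ.+-identityˡ _) ⟩
  crossing -1ℤ V ∎
  where
  open ≡-Reasoning
  zeros : Subset n → ℤ
  zeros X = ∑ℤ.∑ (allFin n) λ j → if does (j ∈? X) then 0ℤ else 0ℤ
  crossings : Fin n → ℤ
  crossings j = if does (j ∈? V) then colourSign (1F , j) else 0ℤ

-- The last column has odd index m, so its bottom node is white and its top node black.
wWeight≡ : ∀ {m} → 2 ∣ suc m → (X Y U V : Subset (suc m)) →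
  wWeight (edgeSet (X ∷ Y ∷ []) (U ∷ V ∷ [])) ≡
  (if lookup X (last m) then -1ℤ else 0ℤ) ℤ.+ (if lookup Y (last m) then 1ℤ else 0ℤ)
wWeight≡ {m} 2∣ X Y U V = begin
  wWeight (edgeSet (X ∷ Y ∷ []) (U ∷ V ∷ []))
    ≡⟨ sumOver≡ wSign (edgeSet (X ∷ Y ∷ []) (U ∷ V ∷ [])) ⟩
  _ ≡⟨ cong₂ ℤ._+_
         (cong₂ ℤ._+_ (∑-last X 0F (trans (sym (ℤ.neg-involutive _))
             (cong ℤ.-_ (trans (sym (paritySign-suc m)) sign))))
           (cong (ℤ._+ 0ℤ) (∑-last Y 1F sign)))
         (cong₂ ℤ._+_ (∑-if-zero U) (cong (ℤ._+ 0ℤ) (∑-if-zero V))) ⟩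
  (x ℤ.+ (y ℤ.+ 0ℤ)) ℤ.+ 0ℤ
    ≡⟨ trans (ℤ.+-identityʳ _) (cong (ℤ._+_ x) (ℤ.+-identityʳ y)) ⟩
  x ℤ.+ y ∎
  where
  open ≡-Reasoning
  x = if lookup X (last m) then -1ℤ else 0ℤ
  y = if lookup Y (last m) then 1ℤ else 0ℤ

  sign : paritySign (suc m) ≡ 1ℤ
  sign = cong (λ t → if t then 1ℤ else -1ℤ) (dec-true (2 ∣? suc m) 2∣)

  ∑-last : ∀ (X : Subset (suc m)) r {s} → paritySign (toℕ r + m) ≡ s →
    ∑ℤ.∑ (allFin (suc m)) (λ j → if does (j ∈? X) then wSign (h r j) else 0ℤ) ≡
    (if lookup X (last m) then s else 0ℤ)
  ∑-last X r refl = trans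
    (∑ℤ.∑-allFin (last m) λ k ≢k → trans
      (cong (λ t → if does (k ∈? X) then (if t then colourSign (r , k) else 0ℤ) else 0ℤ)
        (dec-false (suc (toℕ k) ≟ suc m) λ eq → ≢k (Fin.toℕ-injective
          (trans (Fin.toℕ-fromℕ m) (sym (suc-injective eq))))))
      (if-zero (does (k ∈? X))))
    (trans
      (cong₂ (λ t u → if t then (if u then colourSign (r , last m) else 0ℤ) else 0ℤ)
        (does-∈? (last m) X)
        (dec-true (suc (toℕ (last m)) ≟ suc m) (cong suc (Fin.toℕ-fromℕ m))))
      (cong (λ k → if lookup X (last m) then paritySign (toℕ r + k) else 0ℤ) (Fin.toℕ-fromℕ m)))

-- Matchings as chains

chain⇔ : ∀ {m} p q l s a (X Y U V : Subset m) → Chain p q l s a X Y U V ⇔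
  (Covered p X U V × Covered q Y U V ×
   lookup (p ∷ X) (last m) ≡ l × lookup (q ∷ Y) (last m) ≡ l × crossing s V ≡ a)
chain⇔ p q l s a []      []      []      []      = mk⇔
  (λ (p≡l , q≡l , a≡0) → (λ ()) , (λ ()) , p≡l , q≡l , sym a≡0)
  (λ (_ , _ , p≡l , q≡l , 0≡a) → p≡l , q≡l , sym 0≡a)
chain⇔ p q l s a (x ∷ X) (y ∷ Y) (u ∷ U) (w ∷ V) = mk⇔
  (λ (cx , cy , c) → let cX , cY , eX , eY , z = Equivalence.to IH c in
    (λ { zero → cx ; (suc j) → cX j }) , (λ { zero → cy ; (suc j) → cY j }) ,
    eX , eY , to-weight w z)
  (λ (cX , cY , eX , eY , z) → cX zero , cY zero ,
    Equivalence.from IH (cX ∘ suc , cY ∘ suc , eX , eY , from-weight w z))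
  where
  IH = chain⇔ x y l (ℤ.- s) (if w then a ℤ.- s else a) X Y U V

  to-weight : ∀ w → crossing (ℤ.- s) V ≡ (if w then a ℤ.- s else a) → crossing s (w ∷ V) ≡ a
  to-weight true  z = trans (cong (ℤ._+_ s) z) (identity s a)
    where
    identity : ∀ s a → s ℤ.+ (a ℤ.- s) ≡ a
    identity = solve-∀
  to-weight false z = trans (ℤ.+-identityˡ _) z

  from-weight : ∀ w → crossing s (w ∷ V) ≡ a → crossing (ℤ.- s) V ≡ (if w then a ℤ.- s else a)
  from-weight true  refl = identity s (crossing (ℤ.- s) V)
    where
    identity : ∀ s c → c ≡ s ℤ.+ c ℤ.- s
    identity = solve-∀
  from-weight false z    = trans (sym (ℤ.+-identityˡ _)) z

-- A matching has w-weight 0 exactly when the edges crossing the cycle w are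
-- both present or both absent; cutting the strip there leaves a chain.
matching⇔chain : ∀ {m} → 2 ∣ 2 + m → ∀ a (X Y U V : Subset (2 + m)) →
  let M = edgeSet (X ∷ Y ∷ []) (U ∷ V ∷ []) in
  (PerfectMatching M × zWeight M ≡ a × wWeight M ≡ 0ℤ) ⇔
  (Chain outside outside outside -1ℤ a X Y U V ⊎ Chain inside inside inside -1ℤ a X Y U V)
matching⇔chain {m} 2∣ a X Y U V = mk⇔
  (λ (P , z , w) → to (proj₁ (Equivalence.to PM⇔ P)) (proj₂ (Equivalence.to PM⇔ P))
    (trans (sym (zWeight≡crossing X Y U V)) z)
    (trans (sym (wWeight≡ 2∣ X Y U V)) w))
  (λ { (inj₁ c) → from outside refl c ; (inj₂ c) → from inside refl c })
  where
  M = edgeSet (X ∷ Y ∷ []) (U ∷ V ∷ [])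
  PM⇔ = perfectMatching⇔covered X Y U V

  to : Covered (lookup X (last (suc m))) X U V → Covered (lookup Y (last (suc m))) Y U V →
    crossing -1ℤ V ≡ a →
    (if lookup X (last (suc m)) then -1ℤ else 0ℤ) ℤ.+
    (if lookup Y (last (suc m)) then 1ℤ else 0ℤ) ≡ 0ℤ →
    Chain outside outside outside -1ℤ a X Y U V ⊎ Chain inside inside inside -1ℤ a X Y U V
  to cX cY z w with lookup X (last (suc m)) in eX | lookup Y (last (suc m)) in eY
  -- The two mixed cases are absurd: there `w` would equate 1 or -1 with 0.
  ... | outside | outside = inj₁ (Equivalence.from
          (chain⇔ outside outside outside -1ℤ a X Y U V) (cX , cY , eX , eY , z))
  ... | inside  | inside  = inj₂ (Equivalence.from
          (chain⇔ inside inside inside -1ℤ a X Y U V) (cX , cY , eX , eY , z))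

  from : ∀ l → (if l then -1ℤ else 0ℤ) ℤ.+ (if l then 1ℤ else 0ℤ) ≡ 0ℤ →
    Chain l l l -1ℤ a X Y U V → PerfectMatching M × zWeight M ≡ a × wWeight M ≡ 0ℤ
  from l balanced c with Equivalence.to (chain⇔ l l l -1ℤ a X Y U V) c
  ... | cX , cY , refl , eY , z =
    Equivalence.from PM⇔ (cX , subst (λ l → Covered l Y U V) (sym eY) cY) ,
    trans (zWeight≡crossing X Y U V) z ,
    trans (wWeight≡ 2∣ X Y U V)
      (trans (cong (λ l′ → (if lookup X (last (suc m)) then -1ℤ else 0ℤ) ℤ.+
                           (if l′ then 1ℤ else 0ℤ)) eY)
        balanced)

∑-vectors₂ : ∀ {A : Set} (xs : List A) g →
  ∑ (vectors xs 2) g ≡ ∑ xs λ x → ∑ xs λ y → g (x ∷ y ∷ [])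
∑-vectors₂ xs g = trans (∑-cartesianProductWith _∷_ xs (vectors xs 1) g)
  (∑-cong xs λ x → trans (∑-cartesianProductWith _∷_ xs ([] ∷ []) _)
    (∑-cong xs λ y → +-identityʳ (g (x ∷ y ∷ []))))

∑-edgeSets : ∀ n f → ∑ (edgeSets n) f ≡
  ∑⁴ sides n λ X Y U V → f (edgeSet (X ∷ Y ∷ []) (U ∷ V ∷ []))
∑-edgeSets n f = trans
  (∑-cartesianProductWith edgeSet (vectors (subsets n) 2) (vectors (subsets n) 2) f)
  (trans (∑-vectors₂ (subsets n) _) (∑-cong (subsets n) λ X → ∑-cong (subsets n) λ Y →
    ∑-vectors₂ (subsets n) _))

N≡chains : ∀ m a → 2 ∣ 2 + m → N (2 + m) a 0ℤ ≡
  chains (2 + m) outside outside -1ℤ a + chains (2 + m) inside inside -1ℤ a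
N≡chains m a 2∣ = begin
  N (2 + m) a 0ℤ
    ≡⟨ length-filter good? (edgeSets (2 + m)) ⟩
  ∑ (edgeSets (2 + m)) (λ M → ⟦ good? M ⟧)
    ≡⟨ ∑-edgeSets (2 + m) _ ⟩
  ∑⁴ sides (2 + m) (λ X Y U V → ⟦ good? (edgeSet (X ∷ Y ∷ []) (U ∷ V ∷ [])) ⟧)
    ≡⟨ ∑⁴-cong sides (2 + m) (λ X Y U V → ⟦⟧-⊎ (matching⇔chain 2∣ a X Y U V)
         (exclusive X Y U V)
         (good? (edgeSet (X ∷ Y ∷ []) (U ∷ V ∷ [])))
         (chain? outside outside outside -1ℤ a X Y U V)
         (chain? inside inside inside -1ℤ a X Y U V)) ⟩
  ∑⁴ sides (2 + m) (λ X Y U V → ⟦ chain? outside outside outside -1ℤ a X Y U V ⟧ +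
                                ⟦ chain? inside inside inside -1ℤ a X Y U V ⟧)
    ≡⟨ ∑⁴-+ sides (2 + m) _ _ ⟩
  chains (2 + m) outside outside -1ℤ a + chains (2 + m) inside inside -1ℤ a ∎
  where
  open ≡-Reasoning
  good? : Decidable λ M → PerfectMatching M × zWeight M ≡ a × wWeight M ≡ 0ℤ
  good? M = perfectMatching? M ×-dec (zWeight M ℤ.≟ a) ×-dec (wWeight M ℤ.≟ 0ℤ)

  exclusive : ∀ X Y U V → ¬ (Chain outside outside outside -1ℤ a X Y U V ×
                             Chain inside inside inside -1ℤ a X Y U V)
  exclusive X Y U V (c , c′)
    with Equivalence.to (chain⇔ outside outside outside -1ℤ a X Y U V) c
       | Equivalence.to (chain⇔ inside inside inside -1ℤ a X Y U V) c′
  ... | _ , _ , e , _ | _ , _ , e′ , _ = contradiction (trans (sym e) e′) λ ()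

N≡cyclic : ∀ m a i j → 2 ∣ 2 + m → a ℤ.+ i ≡ + ⌊ 2 + m /2⌋ → i ℤ.+ j ≡ + (2 + m) →
  N (2 + m) a 0ℤ ≡ cyclic i j
N≡cyclic m a i j 2∣ ai ij = trans (N≡chains m a 2∣) (cong₂ _+_
  (outside⇝outside⁻ (2 + m) a i j ai ij)
  (inside⇝inside⁻ (suc m) a i j 2∣ ai ij))

-- Rational coefficients and signs

/1-+ : ∀ x y → (x ℤ.+ y) ℚ./ 1 ≡ x ℚ./ 1 ℚ.+ y ℚ./ 1
/1-+ x y = ℚ.toℚᵘ-injective (begin
  toℚᵘ ((x ℤ.+ y) ℚ./ 1)                 ≈⟨ ℚ.toℚᵘ-fromℚᵘ (mkℚᵘ (x ℤ.+ y) 0) ⟩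
  mkℚᵘ (x ℤ.+ y) 0                       ≈⟨ *≡* (identity x y) ⟩
  mkℚᵘ x 0 ℚᵘ.+ mkℚᵘ y 0
    ≈⟨ ℚᵘ.+-cong (ℚ.toℚᵘ-fromℚᵘ (mkℚᵘ x 0)) (ℚ.toℚᵘ-fromℚᵘ (mkℚᵘ y 0)) ⟨
  toℚᵘ (x ℚ./ 1) ℚᵘ.+ toℚᵘ (y ℚ./ 1)     ≈⟨ ℚ.toℚᵘ-homo-+ (x ℚ./ 1) (y ℚ./ 1) ⟨
  toℚᵘ (x ℚ./ 1 ℚ.+ y ℚ./ 1)             ∎)
  where
  open ≈-Reasoning ℚᵘ.≃-setoid
  identity : ∀ x y → (x ℤ.+ y) ℤ.* 1ℤ ≡ (x ℤ.* 1ℤ ℤ.+ y ℤ.* 1ℤ) ℤ.* 1ℤ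
  identity = solve-∀

/1-* : ∀ x y → (x ℤ.* y) ℚ./ 1 ≡ (x ℚ./ 1) ℚ.* (y ℚ./ 1)
/1-* x y = ℚ.toℚᵘ-injective (begin
  toℚᵘ ((x ℤ.* y) ℚ./ 1)                 ≈⟨ ℚ.toℚᵘ-fromℚᵘ (mkℚᵘ (x ℤ.* y) 0) ⟩
  mkℚᵘ x 0 ℚᵘ.* mkℚᵘ y 0
    ≈⟨ ℚᵘ.*-cong (ℚ.toℚᵘ-fromℚᵘ (mkℚᵘ x 0)) (ℚ.toℚᵘ-fromℚᵘ (mkℚᵘ y 0)) ⟨
  toℚᵘ (x ℚ./ 1) ℚᵘ.* toℚᵘ (y ℚ./ 1)     ≈⟨ ℚ.toℚᵘ-homo-* (x ℚ./ 1) (y ℚ./ 1) ⟨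
  toℚᵘ ((x ℚ./ 1) ℚ.* (y ℚ./ 1))             ∎)
  where open ≈-Reasoning ℚᵘ.≃-setoid

exact-quotient : ∀ x d .{{_ : NonZero d}} {num} → x * d ≡ num → + num ℚ./ d ≡ fromℕ x
exact-quotient x (suc d) refl = ℚ.fromℚᵘ-cong {mkℚᵘ (+ (x * suc d)) d} {mkℚᵘ (+ x) 0}
  (*≡* (trans (ℤ.*-identityʳ _) (ℤ.pos-* x (suc d))))

sign : ℤ → ℤ
sign i = -1ℤ ℤ.^ ∣ i ∣

neg-neg : ∀ s → s ≡ -1ℤ ℤ.* (-1ℤ ℤ.* s)
neg-neg = solve-∀

sign-suc : ∀ i → sign (ℤ.suc i) ≡ -1ℤ ℤ.* sign i
sign-suc (+ n)        = refl
sign-suc -[1+ zero  ] = refl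
sign-suc -[1+ suc n ] = neg-neg (sign -[1+ n ])

-- The origin of the global sign: at the exponent a = p - n/2 the sign of the partition function
-- splits into (-1)^(n/2) and (-1)^p. As `sign` goes through the absolute value, the induction
-- raises a one unit at a time, across 0 if necessary.
sign-+ : ∀ k a {p} → a ℤ.+ + k ≡ + p → sign a ≡ sign (+ k) ℤ.* sign (+ p)
sign-+ zero a eq = trans (cong sign (trans (sym (ℤ.+-identityʳ a)) eq)) (sym (ℤ.*-identityˡ _))
sign-+ (suc k) a {p} eq = begin
  sign a                                      ≡⟨ neg-neg (sign a) ⟩
  -1ℤ ℤ.* (-1ℤ ℤ.* sign a)                    ≡⟨ cong (ℤ._*_ -1ℤ) (sign-suc a) ⟨
  -1ℤ ℤ.* sign (ℤ.suc a)
    ≡⟨ cong (ℤ._*_ -1ℤ) (sign-+ k (ℤ.suc a) (trans (identity a (+ k)) eq)) ⟩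
  -1ℤ ℤ.* (sign (+ k) ℤ.* sign (+ p))         ≡⟨ ℤ.*-assoc -1ℤ (sign (+ k)) (sign (+ p)) ⟨
  sign (+ suc k) ℤ.* sign (+ p)               ∎
  where
  open ≡-Reasoning
  identity : ∀ a k → (1ℤ ℤ.+ a) ℤ.+ k ≡ a ℤ.+ (1ℤ ℤ.+ k)
  identity = solve-∀

-- The sum runs up to i, but the diagonal stops at the smaller of i and j. The terms with j < q are
-- those read as 0 in the formula.
∑-diagonal : ∀ f i j g →
  (∀ q b c → i ≡ q + b → j ≡ q + c → g q ≡ fromℕ (f q b c)) →
  (∀ q → j < q → g q ≡ 0ℚ) →
  ∑[≤ i ] g ≡ fromℕ (diagonal f i j)
∑-diagonal f zero j g g≡f g≡0 =
  trans (ℚ.+-identityʳ (g 0)) (g≡f 0 zero j refl refl)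
∑-diagonal f (suc i) zero g g≡f g≡0 = begin
  ∑[≤ suc i ] g
    ≡⟨ ∑ℚ.∑-upTo-suc (suc i) g ⟩
  g 0 ℚ.+ ∑[≤ i ] (g ∘ suc)
    ≡⟨ cong₂ ℚ._+_ (g≡f 0 (suc i) zero refl refl)
         (trans (∑ℚ.∑-cong (upTo (suc i)) λ q → g≡0 (suc q) (s≤s z≤n)) (∑ℚ.∑-ε (upTo (suc i)))) ⟩
  fromℕ (f 0 (suc i) zero) ℚ.+ 0ℚ
    ≡⟨ ℚ.+-identityʳ _ ⟩
  fromℕ (f 0 (suc i) zero) ∎
  where open ≡-Reasoning
∑-diagonal f (suc i) (suc j) g g≡f g≡0 = begin
  ∑[≤ suc i ] g
    ≡⟨ ∑ℚ.∑-upTo-suc (suc i) g ⟩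
  g 0 ℚ.+ ∑[≤ i ] (g ∘ suc)
    ≡⟨ cong₂ ℚ._+_ (g≡f 0 (suc i) (suc j) refl refl)
         (∑-diagonal (f ∘ suc) i j (g ∘ suc)
           (λ q b c i≡ j≡ → g≡f (suc q) b c (cong suc i≡) (cong suc j≡))
           (λ q j<q → g≡0 (suc q) (s≤s j<q))) ⟩
  fromℕ (f 0 (suc i) (suc j)) ℚ.+ fromℕ (diagonal (f ∘ suc) i j)
    ≡⟨ /1-+ (+ f 0 (suc i) (suc j)) (+ diagonal (f ∘ suc) i j) ⟨
  fromℕ (diagonal f (suc i) (suc j)) ∎
  where open ≡-Reasoning

term-exact : ∀ n p q {x} → q ≤ n ∸ p →
  x * (q ! * (p ∸ q) ! * (n ∸ q ∸ p) !) ≡ n * (n ∸ q ∸ 1) ! → term n p q ≡ fromℕ x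
term-exact n p q {x} q≤ eq rewrite dec-true (q ≤? n ∸ p) q≤ = exact-quotient x _ eq
  where
  instance
    _ = m*n≢0 _ _ {{m*n≢0 _ _ {{q !≢0}} {{(p ∸ q) !≢0}}}} {{(n ∸ q ∸ p) !≢0}}

term-zero : ∀ n p q → n ∸ p < q → term n p q ≡ 0ℚ
term-zero n p q <q rewrite dec-false (q ≤? n ∸ p) (<⇒≱ <q) = refl

regroup : ∀ q b c → (q + b) + (q + c) ≡ q + (q + (b + c))
regroup = solve 3 (λ q b c → (q :+ b) :+ (q :+ c) := q :+ (q :+ (b :+ c))) refl
  where open +-*-Solver

-- In the coordinates p = q + b and n - p = q + c the truncated subtractions are exact: p - q is b,
-- n - q - p is c, and n - q is q + b + c.
term≡coefficient : ∀ q b c {n p} → 0 < n → n ≡ (q + b) + (q + c) → p ≡ q + b →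
  term n p q ≡ fromℕ (coefficient q b c)
term≡coefficient q b c {n} 0<n n≡ refl = term-exact n (q + b) q {coefficient q b c} q≤n∸p (begin
    coefficient q b c * (q ! * (q + b ∸ q) ! * (n ∸ q ∸ (q + b)) !)
      ≡⟨ cong₂ (λ x y → coefficient q b c * (q ! * x ! * y !)) (m+n∸m≡n q b) n∸q∸p≡c ⟩
    coefficient q b c * (q ! * b ! * c !)
      ≡⟨ coefficient-! q b c eq ⟩
    (q + (q + (b + c))) * m !
      ≡⟨ cong₂ (λ x y → x * y !) (trans n≡ (regroup q b c)) (cong (_∸ 1) (trans n∸q≡ eq)) ⟨
    n * (n ∸ q ∸ 1) ! ∎)
  where
  open ≡-Reasoning
  -- This makes n - q - 1 a genuine predecessor: if n - q were 0, then q and with it n would be 0.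
  positive : q + (b + c) ≢ 0
  positive eq = contradiction 0<n (<-irrefl (sym (begin
    n                  ≡⟨ n≡ ⟩
    (q + b) + (q + c)  ≡⟨ regroup q b c ⟩
    q + (q + (b + c))  ≡⟨ cong₂ _+_ (m+n≡0⇒m≡0 q eq) eq ⟩
    0                  ∎)))

  m = pred (q + (b + c))

  eq : q + (b + c) ≡ suc m
  eq = sym (suc-pred (q + (b + c)) {{≢-nonZero positive}})

  n∸q≡ : n ∸ q ≡ q + (b + c)
  n∸q≡ = trans (cong (_∸ q) (trans n≡ (regroup q b c))) (m+n∸m≡n q (q + (b + c)))

  n∸q∸p≡c : n ∸ q ∸ (q + b) ≡ c
  n∸q∸p≡c = trans (cong (_∸ (q + b)) (trans n∸q≡ (sym (+-assoc q b c)))) (m+n∸m≡n (q + b) c)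

  q≤n∸p : q ≤ n ∸ (q + b)
  q≤n∸p = subst (q ≤_) (sym (trans (cong (_∸ (q + b)) n≡) (m+n∸m≡n (q + b) (q + c)))) (m≤m+n q c)

∑-term : ∀ n p → 0 < n → p ≤ n → ∑[≤ p ] (term n p) ≡ fromℕ (cyclic (+ p) (+ (n ∸ p)))
∑-term n p 0<n p≤n = trans
  (∑-diagonal coefficient p (n ∸ p) (term n p)
    (λ q b c p≡ n∸p≡ → term≡coefficient q b c 0<n
      (trans (sym (m+[n∸m]≡n p≤n)) (cong₂ _+_ p≡ n∸p≡)) p≡)
    (term-zero n p))
  (cong fromℕ (sym (cyclic≡diagonal p (n ∸ p))))

-- The Newton polynomial

half : ∀ {n} → 2 ∣ n → n / 2 ≡ ⌊ n /2⌋ × n ≡ n / 2 + n / 2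
half {n} (divides q refl) = trans n/2≡q (trans (n≡⌊n+n/2⌋ q) (cong ⌊_/2⌋ (sym q*2≡q+q))) ,
  trans q*2≡q+q (sym (cong₂ _+_ n/2≡q n/2≡q))
  where
  n/2≡q : q * 2 / 2 ≡ q
  n/2≡q = m*n/n≡m q 2
  q*2≡q+q : q * 2 ≡ q + q
  q*2≡q+q = trans (*-comm q 2) (cong (_+_ q) (+-identityʳ q))

-- Here t is the exponent that remains once z^(-n/2) is factored out. With i = n - t and j = t, both
-- a + i = n/2 and i + j = n hold.
newtonInZ≡ : ∀ m → 2 ∣ 2 + m → ∀ a →
  let n = 2 + m ; t = a ℤ.- (ℤ.- + (n / 2)) in
  newtonInZ n a ≡ (-1^ a) ℚ.* fromℕ (cyclic (+ n ℤ.- t) t)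
newtonInZ≡ m 2∣ a = cong₂ (λ i x → (-1^ i) ℚ.* fromℕ x) (identity₀ a)
  (N≡cyclic m a (+ n ℤ.- t) t 2∣
    (trans (cong (λ n → a ℤ.+ (n ℤ.- t)) (cong +_ (proj₂ (half 2∣))))
      (trans (identity₁ a (+ (n / 2))) (cong +_ (proj₁ (half 2∣)))))
    (identity₂ (+ n) t))
  where
  n = 2 + m
  t = a ℤ.- (ℤ.- + (n / 2))
  identity₀ : ∀ a → a ℤ.+ 0ℤ ℤ.+ a ℤ.* 0ℤ ≡ a
  identity₀ = solve-∀
  identity₁ : ∀ a k → a ℤ.+ ((k ℤ.+ k) ℤ.- (a ℤ.- (ℤ.- k))) ≡ k
  identity₁ = solve-∀
  identity₂ : ∀ n t → (n ℤ.- t) ℤ.+ t ≡ n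
  identity₂ = solve-∀

N-b : ∀ m p → 2 ∣ 2 + m → p ≤ 2 + m → b (2 + m) p ≡ cyclic (+ p) (+ (2 + m ∸ p))
N-b m p 2∣ p≤n = N≡cyclic m (+ ((2 + m) / 2) ℤ.- + p) (+ p) (+ (2 + m ∸ p)) 2∣
  (trans (identity (+ ((2 + m) / 2)) (+ p)) (cong +_ (proj₁ (half 2∣))))
  (cong +_ (m+[n∸m]≡n p≤n))
  where
  identity : ∀ k p → (k ℤ.- p) ℤ.+ p ≡ k
  identity = solve-∀

-- Stated for any c with the right values on the range, as the two claims of the theorem differ only
-- in how the coefficient is written.
expansion : ∀ m → 2 ∣ 2 + m → (c : ℕ → ℚ) →
  (∀ p → p ≤ 2 + m → c p ≡ fromℕ (cyclic (+ p) (+ (2 + m ∸ p)))) →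
  newtonInZ (2 + m) ≗
    -1^ (+ ((2 + m) / 2)) · (z^ (ℤ.- + ((2 + m) / 2)) ⊛ ∑ᴸ[≤ 2 + m ] (λ p →
      -1^ (+ p) · c p · z^ (+ p)))
expansion m 2∣ c c≡ a = trans (newtonInZ≡ m 2∣ a) (coefficients t refl)
  where
  open ≡-Reasoning
  n = 2 + m
  k = n / 2
  t = a ℤ.- (ℤ.- + k)

  summand : ℤ → ℕ → ℚ
  summand t p = (-1^ (+ p)) ℚ.* (c p ℚ.* (z^ (+ p)) t)

  summand-other : ∀ t p → t ≢ + p → summand t p ≡ 0ℚ
  summand-other t p t≢p = trans
    (cong (λ x → (-1^ (+ p)) ℚ.* (c p ℚ.* (if x then 1ℚ else 0ℚ))) (dec-false (t ℤ.≟ + p) t≢p))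
    (trans (cong (ℚ._*_ (-1^ (+ p))) (ℚ.*-zeroʳ (c p))) (ℚ.*-zeroʳ (-1^ (+ p))))

  summand-same : ∀ p → summand (+ p) p ≡ (-1^ (+ p)) ℚ.* c p
  summand-same p = trans
    (cong (λ x → (-1^ (+ p)) ℚ.* (c p ℚ.* (if x then 1ℚ else 0ℚ))) (dec-true (+ p ℤ.≟ + p) refl))
    (cong (ℚ._*_ (-1^ (+ p))) (ℚ.*-identityʳ (c p)))

  outOfRange : ∀ t → (∀ p → p ≤ n → t ≢ + p) → cyclic (+ n ℤ.- t) t ≡ 0 →
    (-1^ a) ℚ.* fromℕ (cyclic (+ n ℤ.- t) t) ≡ (-1^ (+ k)) ℚ.* ∑[≤ n ] (summand t)
  outOfRange t t≢ cyclic≡0 = begin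
    (-1^ a) ℚ.* fromℕ (cyclic (+ n ℤ.- t) t)  ≡⟨ cong (λ x → (-1^ a) ℚ.* fromℕ x) cyclic≡0 ⟩
    (-1^ a) ℚ.* 0ℚ                            ≡⟨ ℚ.*-zeroʳ (-1^ a) ⟩
    0ℚ                                        ≡⟨ ℚ.*-zeroʳ (-1^ (+ k)) ⟨
    (-1^ (+ k)) ℚ.* 0ℚ                        ≡⟨ cong (ℚ._*_ (-1^ (+ k))) (∑ℚ.∑-vanishing
      (All.tabulate λ p∈ → summand-other t _ (t≢ _ (s≤s⁻¹ (∈-upTo⁻ p∈))))) ⟨
    (-1^ (+ k)) ℚ.* ∑[≤ n ] (summand t)       ∎

  coefficients : ∀ t → a ℤ.- (ℤ.- + k) ≡ t →
    (-1^ a) ℚ.* fromℕ (cyclic (+ n ℤ.- t) t) ≡ (-1^ (+ k)) ℚ.* ∑[≤ n ] (summand t)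
  -- `delannoyℤ` inspects its first index first; after the swap the negative index stands there and
  -- `cyclic` computes to 0.
  coefficients -[1+ q ] eq = outOfRange -[1+ q ] (λ _ _ ()) (cyclic-comm (+ n ℤ.- -[1+ q ]) -[1+ q ])
  coefficients (+ p) eq with p ≤? n
  ... | no p≰n = outOfRange (+ p) (λ q q≤n → λ { refl → p≰n q≤n })
    (cong (λ i → cyclic i (+ p)) n-p≡)
    where
    n-p≡ : + n ℤ.- + p ≡ -[1+ (p ∸ suc n) ]
    n-p≡ = trans (ℤ.m-n≡m⊖n n p) (trans (ℤ.⊖-< (≰⇒> p≰n))
      (cong (λ x → ℤ.- + x) (+-∸-assoc 1 (≰⇒> p≰n))))
  ... | yes p≤n = begin
    (-1^ a) ℚ.* fromℕ (cyclic (+ n ℤ.- + p) (+ p))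
      ≡⟨ cong₂ ℚ._*_
           (trans (cong (ℚ._/ 1) (sign-+ k a (trans (identity a (+ k)) eq)))
             (/1-* (sign (+ k)) (sign (+ p))))
           -- The coefficient of z^(p - n/2) counts matchings of z-weight p - n/2, whereas c p is
           -- given by the indices that belong to n/2 - p. The symmetry of `cyclic` identifies the
           -- two.
           (trans (cong fromℕ (trans
             (cong (λ i → cyclic i (+ p)) (trans (ℤ.m-n≡m⊖n n p) (ℤ.⊖-≥ p≤n)))
             (cyclic-comm (+ (n ∸ p)) (+ p)))) (sym (c≡ p p≤n))) ⟩
    ((-1^ (+ k)) ℚ.* (-1^ (+ p))) ℚ.* c p
      ≡⟨ ℚ.*-assoc (-1^ (+ k)) (-1^ (+ p)) (c p) ⟩
    (-1^ (+ k)) ℚ.* ((-1^ (+ p)) ℚ.* c p)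
      ≡⟨ cong (ℚ._*_ (-1^ (+ k))) (trans
           (∑ℚ.∑-only {f = summand (+ p)} (∈-upTo⁺ (s≤s p≤n)) (upTo⁺ (suc n))
             (λ q p≢q → summand-other (+ p) q (p≢q ∘ ℤ.+-injective)))
           (summand-same p)) ⟨
    (-1^ (+ k)) ℚ.* ∑[≤ n ] (summand (+ p)) ∎
    where
    identity : ∀ a k → a ℤ.+ k ≡ a ℤ.- (ℤ.- k)
    identity = solve-∀

mainTheorem4 : (n : ℕ) → 2 ≤ n → 2 ∣ n →
    (newtonInZ n ≗
    -1^ (+ (n / 2)) · (z^ (ℤ.- + (n / 2)) ⊛ ∑ᴸ[≤ n ] (λ p →
    -1^ (+ p) · fromℕ (b n p) · z^ (+ p))))
    ×
    (newtonInZ n ≗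
    -1^ (+ (n / 2)) · (z^ (ℤ.- + (n / 2)) ⊛ ∑ᴸ[≤ n ] (λ p →
    -1^ (+ p) · (∑[≤ p ] (term n p)) · z^ (+ p))))
mainTheorem4 (suc zero) (s≤s ())
mainTheorem4 (suc (suc m)) 2≤n 2∣n =
  expansion m 2∣n (λ p → fromℕ (b (2 + m) p)) (λ p p≤n → cong fromℕ (N-b m p 2∣n p≤n)) ,
  expansion m 2∣n (λ p → ∑[≤ p ] (term (2 + m) p)) (λ p → ∑-term (2 + m) p (s≤s z≤n))
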